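{- Let $n\geq 1$, let $\alpha$ be a composition of $n$ and let $E\in\mathcal E(\alpha)$ be an equivalence class of standard composition tableaux of shape $\alpha$. Then $\operatorname{End}_{H_n(0)}(\mathbf S_{\alpha,E})=\mathbb C\,\mathrm{id}$. In particular, $\mathbf S_{\alpha,E}$ is an indecomposable $H_n(0)$-module.
   Context: The 0-Hecke algebra $H_n(0)$ is the unital associative $\mathbb C$-algebra generated by $\pi_1,\dots,\pi_{n-1}$ subject to $\pi_i^2=\pi_i$, $\pi_i\pi_{i+1}\pi_i=\pi_{i+1}\pi_i\pi_{i+1}$, and $\pi_i\pi_j=\pi_j\pi_i$ for $|i-j|\ge 2$. A composition $\alpha=(\alpha_1,\dots,\alpha_l)$ of $n$ is a sequence of positive integers with sum $n$. Its diagram is $\{(i,j)\in\mathbb N^2: i\le l,\ j\le\alpha_i\}$, drawn in matrix coordinates (row $1$ on top, row $i$ has $\alpha_i$ cells). A standard composition tableau (SCT) of shape $\alpha$ is a bijection $T$ from the diagram of $\alpha$ to $[n]=\{1,\dots,n\}$ such that: (1) entries decrease along each row from left to right; (2) entries of the first column increase from top to bottom; (3) (triple rule) if $(j,k)$ and $(i,k-1)$ are cells of $\alpha$ with $j>i$ and $T(j,k)<T(i,k-1)$, then $(i,k)$ is a cell of $\alpha$ and $T(j,k)<T(i,k)$. Let $\mathrm{SCT}(\alpha)$ be the set of these. For an entry $k$ of $T$ let $c_T(k)$ be the column of the cell $T^{ -1}(k)$. A cell $(i,j)$ attacks a cell $(i',j')$ if either $j=j'$ and $i\ne i'$, or $j=j'-1$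 and $i<i'$; entry $a$ attacks entry $b$ in $T$ if $T^{ -1}(a)$ attacks $T^{ -1}(b)$. Define $D(T)=\{i\in[n-1]: c_T(i)\le c_T(i+1)\}$, $AD(T)=\{i\in D(T): i \text{ attacks } i+1 \text{ in } T\}$, $nAD(T)=D(T)\setminus AD(T)$. The space $\mathbf S_\alpha=\operatorname{span}_{\mathbb C}\mathrm{SCT}(\alpha)$ is an $H_n(0)$-module via $\pi_iT=T$ if $i\notin D(T)$, $\pi_iT=0$ if $i\in AD(T)$, and $\pi_iT=s_iT$ if $i\in nAD(T)$, where $s_iT$ is obtained from $T$ by interchanging the entries $i$ and $i+1$ (it is again an SCT). Two tableaux $T_1,T_2\in\mathrm{SCT}(\alpha)$ are equivalent, $T_1\sim T_2$, if in each column the relative order of the entries of $T_1$ coincides with that of $T_2$. $\mathcal E(\alpha)$ denotes the set of equivalence classes, and for $E\in\mathcal E(\alpha)$, $\mathbf S_{\alpha,E}=\operatorname{span}_{\mathbb C}E$, which is an $H_n(0)$-submodule of $\mathbf S_\alpha$. -}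

module Defs where

open import Level using (Level; _⊔_)
open import Data.Bool using (Bool; true; false; if_then_else_; _∧_; _∨_; not)
open import Data.Nat using (ℕ; zero; suc; _<_; _≤_; _≡ᵇ_; _≤ᵇ_; _<ᵇ_)
import Data.Nat as ℕ
open import Data.Nat.Properties using () renaming (_≟_ to _≟ℕ_)
open import Data.Fin using (Fin)
import Data.Fin as Fin
open import Data.List using (List; []; _∷_; map; concat; length; upTo; lookup)
open import Data.Nat.ListAction using (sum)
open import Data.List.Properties using (≡-dec)
open import Data.List.Relation.Unary.All using (All)
open import Data.List.Relation.Binary.Permutation.Propositional using (_↭_)
open import Data.Maybe using (Maybe; just; nothing)
open import Data.Product using (_×_; _,_; ∃)
open import Relation.Binary.PropositionalEquality using (_≡_)
open import Relation.Nullary using (¬_; does)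
open import Function.Bundles using (_⇔_)
open import Algebra.Bundles using (CommutativeRing)

record IsComposition (n : ℕ) (α : List ℕ) : Set where
  field
    positive : All (1 ≤_) α
    total    : sum α ≡ n

-- Tableaux: list of rows (row 1 first), each row listed left to right.

Tableau : Set
Tableau = List (List ℕ)

nth : {A : Set} → List A → ℕ → Maybe A
nth []       _       = nothing
nth (x ∷ xs) zero    = just x
nth (x ∷ xs) (suc k) = nth xs k

-- entry T i j = T(i,j), 1-based matrix coordinates; nothing if (i,j) is not a cell
entry : Tableau → ℕ → ℕ → Maybe ℕ
entry T zero    _       = nothing
entry T (suc i) zero    = nothing
entry T (suc i) (suc j) with nth T i
... | nothing  = nothing
... | just row = nth row j

[1…_] : ℕ → List ℕ
[1… n ] = map suc (upTo n)

record SCT (n : ℕ) (α : List ℕ) (T : Tableau) : Set where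
  field
    shape     : map length T ≡ α
    bijective : concat T ↭ [1… n ]
    rowDec    : ∀ i j a b → entry T i j ≡ just a → entry T i (suc j) ≡ just b → b < a
    colInc    : ∀ i j a b → i < j → entry T i 1 ≡ just a → entry T j 1 ≡ just b → a < b
    triple    : ∀ i j k a b → i < j → entry T j (suc k) ≡ just b → entry T i k ≡ just a →
                b < a → ∃ λ c → entry T i (suc k) ≡ just c × b < c

_∼_ : Tableau → Tableau → Set
T₁ ∼ T₂ = ∀ r r' k a b a' b' →
  entry T₁ r k ≡ just a → entry T₁ r' k ≡ just b →
  entry T₂ r k ≡ just a' → entry T₂ r' k ≡ just b' →
  (a < b ⇔ a' < b')

posRow : ℕ → List ℕ → ℕ → Maybe ℕ
posRow k []       c = nothing
posRow k (x ∷ xs) c = if x ≡ᵇ k then just c else posRow k xs (suc c)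

posFrom : ℕ → Tableau → ℕ → Maybe (ℕ × ℕ)
posFrom k []           r = nothing
posFrom k (row ∷ rows) r with posRow k row 1
... | just c  = just (r , c)
... | nothing = posFrom k rows (suc r)

-- T⁻¹(k) = (row, column), 1-based
pos : Tableau → ℕ → Maybe (ℕ × ℕ)
pos T k = posFrom k T 1

inD : Tableau → ℕ → Bool
inD T i with pos T i | pos T (suc i)
... | just (_ , c) | just (_ , c') = c ≤ᵇ c'
... | _ | _ = false

cellAttacks : ℕ × ℕ → ℕ × ℕ → Bool
cellAttacks (r , c) (r' , c') =
  ((c ≡ᵇ c') ∧ not (r ≡ᵇ r')) ∨ ((suc c ≡ᵇ c') ∧ (r <ᵇ r'))

attacksNext : Tableau → ℕ → Bool
attacksNext T i with pos T i | pos T (suc i)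
... | just p | just q = cellAttacks p q
... | _ | _ = false

swapEntry : ℕ → ℕ → ℕ
swapEntry i x = if x ≡ᵇ i then suc i else (if x ≡ᵇ suc i then i else x)

sᵢ : ℕ → Tableau → Tableau
sᵢ i T = map (map (swapEntry i)) T

_==T_ : Tableau → Tableau → Bool
T ==T U = does (≡-dec (≡-dec _≟ℕ_) T U)

module _ {c ℓ : Level} (K : CommutativeRing c ℓ) where
  open CommutativeRing K

  -- K is a field of characteristic zero (stand-in for ℂ)
  natK : ℕ → Carrier
  natK zero    = 0#
  natK (suc m) = 1# + natK m

  record IsChar0Field : Set (c ⊔ ℓ) where
    field
      nontrivial : ¬ (1# ≈ 0#)
      inverse    : ∀ x → ¬ (x ≈ 0#) → ∃ λ y → x * y ≈ 1#
      char0      : ∀ m → natK m ≈ 0# → m ≡ 0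

  ind : Bool → Carrier
  ind true  = 1#
  ind false = 0#

  Σ[_] : {m : ℕ} → (Fin m → Carrier) → Carrier
  Σ[_] {zero}  f = 0#
  Σ[_] {suc m} f = f Fin.zero + Σ[ (λ k → f (Fin.suc k)) ]

  -- square matrices indexed by Fin m; M k j = coefficient of basis vector k in M(basis vector j)
  Mat : ℕ → Set c
  Mat m = Fin m → Fin m → Carrier

  πCoeff : ℕ → Tableau → Tableau → Carrier
  πCoeff i T U =
    if not (inD T i) then ind (U ==T T)
    else (if attacksNext T i then 0# else ind (U ==T sᵢ i T))

  -- matrix of π_i on S_{α,E} in the ordered basis Es of E
  πMat : (Es : List Tableau) → ℕ → Mat (length Es)
  πMat Es i k j = πCoeff i (lookup Es j) (lookup Es k)

  -- M is the matrix of an H_n(0)-module endomorphism: commutes with all π_i, 1 ≤ i ≤ n-1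
  IsEndo : ℕ → (Es : List Tableau) → Mat (length Es) → Set ℓ
  IsEndo n Es M = ∀ i → 1 ≤ i → i < n → ∀ k j →
    Σ[ (λ l → M k l * πMat Es i l j) ] ≈ Σ[ (λ l → πMat Es i k l * M l j) ]

  IsScalar : (m : ℕ) → Mat m → Set (c ⊔ ℓ)
  IsScalar m M = ∃ λ (λ₀ : Carrier) → ∀ k j →
    M k j ≈ (if does (k Fin.≟ j) then λ₀ else 0#)

{-# OPTIONS --safe #-}
module Submission where

open import Defs
open import Level using (Level)
open import Data.Bool using (true; false; T; if_then_else_; not; _∧_)
open import Data.Nat using (ℕ; zero; suc; _+_; _∸_; _<_; _≤_; _≡ᵇ_; _≤ᵇ_; _<ᵇ_; z≤n; s≤s)
open import Data.Nat.Properties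
  using (_≟_; _≤?_; _<?_; <-cmp; suc-injective; n<1+n; n≤1+n; 1+n≢n; ≡ᵇ⇒≡; <ᵇ⇒<;
         ≤-refl; ≤-reflexive; ≤-trans; ≤-antisym; <-trans; <-asym; <-irrefl; ≤-<-trans; <-≤-trans;
         <⇒≤; <⇒≢; <⇒≱; ≰⇒>; ≮⇒≥; ≤∧≢⇒<; m≤n⇒m<n∨m≡n; m<1+n⇒m≤n; m<n⇒m<1+n; m≤n⇒m≤1+n;
         m≤m+n; m≤n+m; m∸n+n≡m; +-suc; +-comm; +-assoc;
         +-monoˡ-≤; +-monoʳ-≤; +-monoʳ-<; +-mono-≤-<; +-mono-<-≤)
open import Data.Nat.Induction using (<-wellFounded)
open import Data.Fin as Fin using (Fin)
open import Data.Fin.Properties using () renaming (suc-injective to Fin-suc-injective)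
open import Data.List using (List; []; _∷_; _++_; map; concat; length; lookup; applyUpTo)
open import Data.List.Properties
  using (map-applyUpTo; map-upTo; length-map; concat-map; ∷-injective) renaming (≡-dec to List-≡-dec)
open import Data.List.Membership.Propositional using (_∈_)
open import Data.List.Membership.Propositional.Properties
  using (∈-++⁺ˡ; ∈-++⁺ʳ; ∈-++⁻; ∈-map⁺; ∈-map⁻; ∈-upTo⁺; ∈-upTo⁻; ∈-lookup)
open import Data.List.Relation.Unary.All as All using (All; []; _∷_)
open import Data.List.Relation.Unary.AllPairs using ([]; _∷_)
open import Data.List.Relation.Unary.Any using (here; there; index)
open import Data.List.Relation.Unary.Any.Properties using (lookup-index)
open import Data.List.Relation.Unary.Unique.Propositional using (Unique)
open import Data.List.Relation.Unary.Unique.Propositional.Properties as Unique using (Unique[x∷xs]⇒x∉xs)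
open import Data.List.Relation.Binary.Permutation.Propositional as Perm
  using (_↭_; ↭-refl; ↭-sym; ↭-trans; ↭-reflexive; prep)
open import Data.List.Relation.Binary.Permutation.Propositional.Properties as Perm using (∈-resp-↭)
import Data.List.Relation.Binary.Permutation.Setoid.Properties as PermS
open import Data.Maybe as Maybe using (Maybe; just; nothing; _>>=_; maybe)
open import Data.Maybe.Properties using (just-injective)
open import Data.Product using (_×_; _,_; ∃; ∃₂; proj₁; proj₂)
open import Data.Product.Properties using (,-injectiveˡ; ,-injectiveʳ; ≡-dec)
open import Data.Sum using (_⊎_; inj₁; inj₂; [_,_]′)
open import Data.Empty using (⊥-elim)
open import Relation.Binary using (tri<; tri≈; tri>)
open import Relation.Binary.PropositionalEquality as ≡
  using (_≡_; refl; sym; trans; cong; cong₂; subst; subst₂; module ≡-Reasoning)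
open import Relation.Nullary using (¬_; Dec; yes; no; does)
open import Relation.Nullary.Decidable using (dec-true; dec-false)
open import Induction.WellFounded using (Acc; acc)
open import Function using (_∘_; id)
open import Function.Bundles using (_⇔_; mk⇔; Equivalence)
open import Algebra.Bundles using (CommutativeRing)
import Algebra.Properties.Semiring.Sum as SemiringSum
import Relation.Binary.Reasoning.Setoid as SetoidReasoning

-- Every class has a unique source tableau S, in which i + 1 lies to the left of i only as its left
-- neighbour, and S generates the module. So it suffices that an endomorphism f maps S to a multiple
-- of S. Let T ≠ S and let m be the largest entry whose cells in S and T differ; m lies further left
-- in T than in S. If m ∈ D(T) \ D(S), then T does not occur in f(S), because π_m f(S) = f(S).
-- Otherwise let q be the first entry above m in S that is not strictly to the right of m. It lies in
-- the column of m, so π_{q-1} ⋯ π_{m+1} π_m kills S, and with it every tableau having m, …, q at the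
-- same cells as S. On the tableaux with the same m as T it acts as zero or as one fixed permutation of
-- the entries, and by the triple rule it does not kill T. Descending induction on m removes the rest.

-- That m lies further left in T rests on `source-inversion`: if v < b in S and b is in a column
-- strictly left of that of v, then the entries of T at these two cells are in the same order. The
-- equivalence fixes orders within columns only; the source property extends some of them across
-- columns. In S the cell that holds m in T carries an entry below m, and in T the cell that holds m
-- in S does too. So a move of m to the right, or within its column, would reverse an order that S
-- forces on the whole class.
--
-- Since m lies further left in T, its column in S is not the first, and its left neighbour in S is
-- a larger entry further left; hence q exists. If q > m + 1, then q - 1 is strictly right of m, and
-- a source steps left by one column only, so q cannot overshoot the column of m. For q = m + 1 this
-- argument fails, as q could be the left neighbour of m. The case of m in D(T) but not in D(S) is
-- split off for this reason: outside it, such a q would also lie strictly left of m in T, whereas m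
-- in T is at most as far right as that neighbour.

-- Cells and entries of a tableau

infix 4 _[_,_]=_

-- A record rather than a synonym for the equation: its indices can then be inferred by unification.
record _[_,_]=_ (T : Tableau) (r c a : ℕ) : Set where
  constructor at
  field entry≡ : entry T r c ≡ just a

open _[_,_]=_ public

at-unique : ∀ {T r c a b} → T [ r , c ]= a → T [ r , c ]= b → a ≡ b
at-unique (at p) (at q) = just-injective (trans (sym p) q)

entry-∷ : ∀ row T i c → entry (row ∷ T) (suc (suc i)) c ≡ entry T (suc i) c
entry-∷ row T i zero    = refl
entry-∷ row T i (suc c) with nth T i
... | nothing = refl
... | just _  = refl

at-∷⁺ : ∀ {row T i c a} → T [ suc i , c ]= a → (row ∷ T) [ suc (suc i) , c ]= a
at-∷⁺ {row} {T} {i} {c} (at p) = at (trans (entry-∷ row T i c) p)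

at-∷⁻ : ∀ {row T i c a} → (row ∷ T) [ suc (suc i) , c ]= a → T [ suc i , c ]= a
at-∷⁻ {row} {T} {i} {c} (at p) = at (trans (sym (entry-∷ row T i c)) p)

at-col-pos : ∀ {T r c a} → T [ r , c ]= a → 1 ≤ c
at-col-pos {r = zero}          (at ())
at-col-pos {r = suc r} {zero}  (at ())
at-col-pos {r = suc r} {suc c} (at p) = s≤s z≤n

nth-map : ∀ {A B : Set} (f : A → B) xs k → nth (map f xs) k ≡ Maybe.map f (nth xs k)
nth-map f []       k       = refl
nth-map f (x ∷ xs) zero    = refl
nth-map f (x ∷ xs) (suc k) = nth-map f xs k

entry-map : ∀ f T r c → entry (map (map f) T) r c ≡ Maybe.map f (entry T r c)
entry-map f T zero    c    = refl
entry-map f T (suc i) zero = refl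
entry-map f [] (suc i) (suc j) = refl
entry-map f (row ∷ T) (suc zero) (suc j) = nth-map f row j
entry-map f (row ∷ T) (suc (suc i)) (suc j) = begin
  entry (map f row ∷ map (map f) T) (suc (suc i)) (suc j)  ≡⟨ entry-∷ (map f row) (map (map f) T) i (suc j) ⟩
  entry (map (map f) T) (suc i) (suc j)                    ≡⟨ entry-map f T (suc i) (suc j) ⟩
  Maybe.map f (entry T (suc i) (suc j))                    ≡⟨ cong (Maybe.map f) (entry-∷ row T i (suc j)) ⟨
  Maybe.map f (entry (row ∷ T) (suc (suc i)) (suc j))      ∎
  where open ≡-Reasoning

at-map⁺ : ∀ {f T r c a} → T [ r , c ]= a → map (map f) T [ r , c ]= f a
at-map⁺ {f} {T} {r} {c} (at p) = at (trans (entry-map f T r c) (cong (Maybe.map f) p))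

at-map⁻ : ∀ {f T r c a} → map (map f) T [ r , c ]= a → ∃ λ b → T [ r , c ]= b × a ≡ f b
at-map⁻ {f} {T} {r} {c} (at p) with entry T r c in eq | trans (sym (entry-map f T r c)) p
... | just b | refl = b , at eq , refl

nth-length : ∀ {A B : Set} {xs : List A} {ys : List B} k {a} →
  length xs ≡ length ys → nth xs k ≡ just a → ∃ λ b → nth ys k ≡ just b
nth-length {xs = x ∷ xs} {y ∷ ys} zero    e p = y , refl
nth-length {xs = x ∷ xs} {y ∷ ys} (suc k) e p = nth-length {xs = xs} {ys} k (suc-injective e) p

at-shape : ∀ {T T' r c a} → map length T ≡ map length T' → T [ r , c ]= a → ∃ λ b → T' [ r , c ]= b
at-shape {T = []}      {r = suc r} {suc c} e (at ())
at-shape {T = row ∷ T} {row' ∷ T'} {suc zero} {suc c} e (at p) =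
  let b , q = nth-length {xs = row} {row'} c (proj₁ (∷-injective e)) p in b , at q
at-shape {T = row ∷ T} {row' ∷ T'} {suc (suc r)} e p =
  let b , q = at-shape (proj₂ (∷-injective e)) (at-∷⁻ p) in b , at-∷⁺ q

nth-pred : ∀ {A : Set} (xs : List A) k {a} → nth xs (suc k) ≡ just a → ∃ λ b → nth xs k ≡ just b
nth-pred (x ∷ xs) zero    p = x , refl
nth-pred (x ∷ xs) (suc k) p = nth-pred xs k p

at-left : ∀ {T r c a} → 1 ≤ c → T [ r , suc c ]= a → ∃ λ b → T [ r , c ]= b
at-left {[]}      {suc r}       {suc c} _ (at ())
at-left {row ∷ T} {suc zero}    {suc c} _ (at p) = let b , q = nth-pred row c p in b , at q
at-left {row ∷ T} {suc (suc r)} {suc c} l p = let b , q = at-left l (at-∷⁻ p) in b , at-∷⁺ q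

at-between : ∀ {T r c a} d → T [ r , d + c ]= a → 1 ≤ c → ∃ λ b → T [ r , c ]= b
at-between zero    p l = _ , p
at-between (suc d) p l = at-between d (proj₂ (at-left (≤-trans l (m≤n+m _ d)) p)) l

nth-ext : ∀ {A : Set} (xs ys : List A) → length xs ≡ length ys →
  (∀ k a → nth xs k ≡ just a → nth ys k ≡ just a) → xs ≡ ys
nth-ext []       []       e h = refl
nth-ext (x ∷ xs) (y ∷ ys) e h =
  cong₂ _∷_ (sym (just-injective (h 0 x refl))) (nth-ext xs ys (suc-injective e) (λ k → h (suc k)))

at-ext : ∀ T T' → map length T ≡ map length T' → (∀ {r c a} → T [ r , c ]= a → T' [ r , c ]= a) → T ≡ T'
at-ext []        []          e h = refl
at-ext (row ∷ T) (row' ∷ T') e h = cong₂ _∷_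
  (nth-ext row row' (proj₁ (∷-injective e)) (λ k a p → entry≡ (h {1} {suc k} (at p))))
  (at-ext T T' (proj₂ (∷-injective e)) rest)
  where
  rest : ∀ {r c a} → T [ r , c ]= a → T' [ r , c ]= a
  rest {zero}  (at ())
  rest {suc r} p = at-∷⁻ (h (at-∷⁺ p))

-- Entries as a list, and injectivity of the filling

nth⇒∈ : ∀ {A : Set} (xs : List A) k {a} → nth xs k ≡ just a → a ∈ xs
nth⇒∈ (x ∷ xs) zero    refl = here refl
nth⇒∈ (x ∷ xs) (suc k) p    = there (nth⇒∈ xs k p)

∈⇒nth : ∀ {A : Set} {xs : List A} {a} → a ∈ xs → ∃ λ k → nth xs k ≡ just a
∈⇒nth (here refl) = 0 , refl
∈⇒nth (there p)   = let k , q = ∈⇒nth p in suc k , q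

at⇒∈ : ∀ {T r c a} → T [ r , c ]= a → a ∈ concat T
at⇒∈ {[]}      {suc r}       {suc c} (at ())
at⇒∈ {row ∷ T} {suc zero}    {suc c} (at p) = ∈-++⁺ˡ (nth⇒∈ row c p)
at⇒∈ {row ∷ T} {suc (suc r)}         p      = ∈-++⁺ʳ row (at⇒∈ (at-∷⁻ p))

∈⇒at : ∀ T {a} → a ∈ concat T → ∃₂ λ r c → T [ r , c ]= a
∈⇒at (row ∷ T) p with ∈-++⁻ row p
... | inj₁ q = let k , e = ∈⇒nth q in 1 , suc k , at e
... | inj₂ q with ∈⇒at T q
...   | zero  , c , at ()
...   | suc r , c , e = suc (suc r) , c , at-∷⁺ e

unique-++⁻ : ∀ {A : Set} (xs : List A) {ys} → Unique (xs ++ ys) →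
  Unique xs × Unique ys × (∀ {a} → a ∈ xs → ¬ a ∈ ys)
unique-++⁻ []       u = [] , u , λ ()
unique-++⁻ (x ∷ xs) u@(px ∷ pu) with unique-++⁻ xs pu
... | uxs , uys , disj =
  All.tabulate (λ m → All.lookup px (∈-++⁺ˡ m)) ∷ uxs , uys ,
  λ { (here refl) m → Unique[x∷xs]⇒x∉xs u (∈-++⁺ʳ xs m) ; (there k) m → disj k m }

nth-injective : ∀ {A : Set} {xs : List A} → Unique xs → ∀ i j {a} →
  nth xs i ≡ just a → nth xs j ≡ just a → i ≡ j
nth-injective {xs = x ∷ xs} u        zero    zero    p    q    = refl
nth-injective {xs = x ∷ xs} u        zero    (suc j) refl q    = ⊥-elim (Unique[x∷xs]⇒x∉xs u (nth⇒∈ xs j q))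
nth-injective {xs = x ∷ xs} u        (suc i) zero    p    refl = ⊥-elim (Unique[x∷xs]⇒x∉xs u (nth⇒∈ xs i p))
nth-injective {xs = x ∷ xs} (_ ∷ u)  (suc i) (suc j) p    q    = cong suc (nth-injective u i j p q)

Injective : Tableau → Set
Injective T = ∀ {r c r' c' k} → T [ r , c ]= k → T [ r' , c' ]= k → (r , c) ≡ (r' , c')

unique⇒injective : ∀ {T} → Unique (concat T) → Injective T
unique⇒injective {[]} u {suc r} {suc c} (at ()) q
unique⇒injective {row ∷ T} u {suc zero} {suc c} {suc zero} {suc c'} (at p) (at q) =
  cong (λ x → 1 , suc x) (nth-injective (proj₁ (unique-++⁻ row u)) c c' p q)
unique⇒injective {row ∷ T} u {suc zero} {suc c} {suc (suc r')} (at p) q =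
  ⊥-elim (proj₂ (proj₂ (unique-++⁻ row u)) (nth⇒∈ row c p) (at⇒∈ (at-∷⁻ q)))
unique⇒injective {row ∷ T} u {suc (suc r)} {c} {suc zero} {suc c'} p (at q) =
  ⊥-elim (proj₂ (proj₂ (unique-++⁻ row u)) (nth⇒∈ row c' q) (at⇒∈ (at-∷⁻ p)))
unique⇒injective {row ∷ T} u {suc (suc r)} {c} {suc (suc r')} {c'} p q =
  cong (λ x → suc (proj₁ x) , proj₂ x)
    (unique⇒injective (proj₁ (proj₂ (unique-++⁻ row u))) (at-∷⁻ p) (at-∷⁻ q))

-- Computed positions, descents and attacks

≡ᵇ-true : ∀ {m n} → m ≡ n → (m ≡ᵇ n) ≡ true
≡ᵇ-true {m} {n} e = dec-true (m ≟ n) e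

≡ᵇ-false : ∀ {m n} → ¬ m ≡ n → (m ≡ᵇ n) ≡ false
≡ᵇ-false {m} {n} e = dec-false (m ≟ n) e

≡ᵇ-sound : ∀ {m n} → (m ≡ᵇ n) ≡ true → m ≡ n
≡ᵇ-sound {m} {n} e = ≡ᵇ⇒≡ m n (subst T (sym e) _)

posRow-sound : ∀ k xs c₀ {c} → posRow k xs c₀ ≡ just c → ∃ λ j → c ≡ j + c₀ × nth xs j ≡ just k
posRow-sound k (x ∷ xs) c₀ p with x ≡ᵇ k in eq
posRow-sound k (x ∷ xs) c₀ refl | true  = 0 , refl , cong just (≡ᵇ-sound eq)
posRow-sound k (x ∷ xs) c₀ p    | false with posRow-sound k xs (suc c₀) p
... | j , e , q = suc j , trans e (+-suc j c₀) , q

posRow-complete : ∀ k xs c₀ j → nth xs j ≡ just k → ¬ posRow k xs c₀ ≡ nothing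
posRow-complete k (x ∷ xs) c₀ zero    refl e rewrite ≡ᵇ-true {k} refl with e
... | ()
posRow-complete k (x ∷ xs) c₀ (suc j) p    e with x ≡ᵇ k
... | false = posRow-complete k xs (suc c₀) j p e

posFrom-sound : ∀ k T r₀ {r c} → posFrom k T r₀ ≡ just (r , c) → ∃ λ i → r ≡ i + r₀ × T [ suc i , c ]= k
posFrom-sound k (row ∷ T) r₀ p with posRow k row 1 in eq
posFrom-sound k (row ∷ T) r₀ refl | just c with posRow-sound k row 1 eq
... | j , refl , q rewrite +-comm j 1 = 0 , refl , at q
posFrom-sound k (row ∷ T) r₀ p | nothing with posFrom-sound k T (suc r₀) p
... | i , e , q = suc i , trans e (+-suc i r₀) , at-∷⁺ q

posFrom-complete : ∀ {k T r c} r₀ → T [ r , c ]= k → ¬ posFrom k T r₀ ≡ nothing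
posFrom-complete {T = []} {suc r} {suc c} r₀ (at ()) e
posFrom-complete {k} {row ∷ T} {suc zero} {suc c} r₀ (at p) e with posRow k row 1 in eq
... | nothing = posRow-complete k row 1 c p eq
posFrom-complete {k} {row ∷ T} {suc (suc r)} r₀ p e with posRow k row 1
... | nothing = posFrom-complete (suc r₀) (at-∷⁻ p) e

at⇒pos : ∀ {T r c k} → Injective T → T [ r , c ]= k → pos T k ≡ just (r , c)
at⇒pos {T} {k = k} inj p with pos T k in eq
... | nothing = ⊥-elim (posFrom-complete 1 p eq)
... | just (r' , c') with posFrom-sound k T 1 eq
...   | i , refl , q rewrite +-comm i 1 = cong just (inj q p)

inD-at : ∀ {T i r c r' c'} → Injective T → T [ r , c ]= i → T [ r' , c' ]= suc i → inD T i ≡ (c ≤ᵇ c')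
inD-at inj p q rewrite at⇒pos inj p | at⇒pos inj q = refl

attacksNext-at : ∀ {T i r c r' c'} → Injective T → T [ r , c ]= i → T [ r' , c' ]= suc i →
  attacksNext T i ≡ cellAttacks (r , c) (r' , c')
attacksNext-at inj p q rewrite at⇒pos inj p | at⇒pos inj q = refl

-- Adjacent transpositions of the entries

data SwapView (i : ℕ) : ℕ → ℕ → Set where
  low   : SwapView i i (suc i)
  high  : SwapView i (suc i) i
  other : ∀ {x} → ¬ x ≡ i → ¬ x ≡ suc i → SwapView i x x

swapView : ∀ i x → SwapView i x (swapEntry i x)
swapView i x with x ≟ i
... | yes refl rewrite ≡ᵇ-true {i} refl = low
... | no x≢i rewrite ≡ᵇ-false x≢i with x ≟ suc i
...   | yes refl rewrite ≡ᵇ-true {i} refl = high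
...   | no x≢si rewrite ≡ᵇ-false x≢si = other x≢i x≢si

swapView-functional : ∀ {i x y z} → SwapView i x y → SwapView i x z → y ≡ z
swapView-functional low         low         = refl
swapView-functional low         (other p _) = ⊥-elim (p refl)
swapView-functional high        high        = refl
swapView-functional high        (other _ p) = ⊥-elim (p refl)
swapView-functional (other p _) low         = ⊥-elim (p refl)
swapView-functional (other _ p) high        = ⊥-elim (p refl)
swapView-functional (other _ _) (other _ _) = refl

-- A view read backwards is again a view; as views are functional, `swapEntry` is an involution.
swapView-sym : ∀ {i x y} → SwapView i x y → SwapView i y x
swapView-sym low         = high
swapView-sym high        = low
swapView-sym (other p q) = other p q

swap-low : ∀ i → swapEntry i i ≡ suc i
swap-low i = swapView-functional (swapView i i) low

swap-high : ∀ i → swapEntry i (suc i) ≡ i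
swap-high i = swapView-functional (swapView i (suc i)) high

swap-other : ∀ {i x} → ¬ x ≡ i → ¬ x ≡ suc i → swapEntry i x ≡ x
swap-other {i} {x} p q = swapView-functional (swapView i x) (other p q)

swap-involutive : ∀ i x → swapEntry i (swapEntry i x) ≡ x
swap-involutive i x = swapView-functional (swapView i (swapEntry i x)) (swapView-sym (swapView i x))

swap-injective : ∀ i {x y} → swapEntry i x ≡ swapEntry i y → x ≡ y
swap-injective i {x} {y} e =
  trans (sym (swap-involutive i x)) (trans (cong (swapEntry i) e) (swap-involutive i y))

-- The order conditions of a tableau and the relation `∼` compare two entries at a time, and the
-- excluded pair is the only comparison that the transposition can spoil. Their preservation thus
-- reduces to checking that i and i + 1 are not the two entries compared.
swap-mono : ∀ i {a b} → a < b → ¬ (a ≡ i × b ≡ suc i) → swapEntry i a < swapEntry i b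
swap-mono i {a} {b} a<b h = go (swapView i a) (swapView i b) a<b h
  where
  go : ∀ {a b a' b'} → SwapView i a a' → SwapView i b b' → a < b → ¬ (a ≡ i × b ≡ suc i) → a' < b'
  go low         low         l h = ⊥-elim (<-irrefl refl l)
  go low         high        l h = ⊥-elim (h (refl , refl))
  go low         (other p q) l h = ≤∧≢⇒< l (q ∘ sym)
  go high        low         l h = ⊥-elim (<-asym l (n<1+n i))
  go high        high        l h = ⊥-elim (<-irrefl refl l)
  go high        (other p q) l h = <-trans (n<1+n i) l
  go (other p q) low         l h = m<n⇒m<1+n l
  go (other p q) high        l h = ≤∧≢⇒< (m<1+n⇒m≤n l) p
  go (other _ _) (other _ _) l h = l

sᵢ-shape : ∀ i T → map length (sᵢ i T) ≡ map length T
sᵢ-shape i []        = refl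
sᵢ-shape i (row ∷ T) = cong₂ _∷_ (length-map (swapEntry i) row) (sᵢ-shape i T)

sᵢ-involutive : ∀ i T → sᵢ i (sᵢ i T) ≡ T
sᵢ-involutive i T = at-ext _ _ (trans (sᵢ-shape i (sᵢ i T)) (sᵢ-shape i T)) back
  where
  back : ∀ {r c a} → sᵢ i (sᵢ i T) [ r , c ]= a → T [ r , c ]= a
  back p with at-map⁻ p
  ... | _ , q , refl with at-map⁻ q
  ...   | b , q' , refl = subst (T [ _ , _ ]=_) (sym (swap-involutive i b)) q'

applyUpTo-swap : ∀ (f g : ℕ → ℕ) i n → suc i < n → g i ≡ f (suc i) → g (suc i) ≡ f i →
  (∀ x → ¬ x ≡ i → ¬ x ≡ suc i → g x ≡ f x) → applyUpTo g n ↭ applyUpTo f n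
applyUpTo-swap f g zero (suc (suc n)) l e₀ e₁ h =
  ↭-trans (↭-reflexive (cong₂ _∷_ e₀ (cong₂ _∷_ e₁ (applyUpTo-cong n (λ x → h (suc (suc x)) (λ ()) (λ ()))))))
          (Perm.swap _ _ ↭-refl)
  where
  applyUpTo-cong : ∀ {f g : ℕ → ℕ} n → (∀ x → g x ≡ f x) → applyUpTo g n ≡ applyUpTo f n
  applyUpTo-cong zero    h = refl
  applyUpTo-cong (suc n) h = cong₂ _∷_ (h 0) (applyUpTo-cong n (h ∘ suc))
applyUpTo-swap f g zero (suc zero) (s≤s ()) e₀ e₁ h
applyUpTo-swap f g (suc i) (suc n) (s≤s l) e₀ e₁ h =
  ↭-trans (↭-reflexive (cong (_∷ _) (h 0 (λ ()) (λ ()))))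
    (prep _ (applyUpTo-swap (f ∘ suc) (g ∘ suc) i n l e₀ e₁
      (λ x p q → h (suc x) (p ∘ suc-injective) (q ∘ suc-injective))))

swap-↭ : ∀ n i → 1 ≤ i → i < n → map (swapEntry i) [1… n ] ↭ [1… n ]
swap-↭ n (suc i) _ l rewrite map-upTo suc n | map-applyUpTo suc (swapEntry (suc i)) n =
  applyUpTo-swap suc (swapEntry (suc i) ∘ suc) i n l (swap-low (suc i)) (swap-high (suc i))
    (λ x p q → swap-other (p ∘ suc-injective) (q ∘ suc-injective))

-- Standard composition tableaux under transpositions

open SCT

<⇒≡suc+ : ∀ {m n} → m < n → ∃ λ o → n ≡ suc (o + m)
<⇒≡suc+ {m} {n} l = n ∸ suc m , sym (trans (sym (+-suc _ m)) (m∸n+n≡m l))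

module _ {n : ℕ} {α : List ℕ} {T : Tableau} (sct : SCT n α T) where

  sct-injective : Injective T
  sct-injective = unique⇒injective
    (PermS.Unique-resp-↭ (≡.setoid ℕ) (Perm.↭⇒↭ₛ (↭-sym (bijective sct)))
      (Unique.map⁺ suc-injective (Unique.upTo⁺ n)))

  at-bounds : ∀ {r c a} → T [ r , c ]= a → 1 ≤ a × a ≤ n
  at-bounds p with ∈-map⁻ suc (∈-resp-↭ (bijective sct) (at⇒∈ p))
  ... | _ , q , refl = s≤s z≤n , ∈-upTo⁻ q

  locate : ∀ {k} → 1 ≤ k → k ≤ n → ∃₂ λ r c → T [ r , c ]= k
  locate {suc k} _ l = ∈⇒at T (∈-resp-↭ (↭-sym (bijective sct)) (∈-map⁺ suc (∈-upTo⁺ l)))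

  row-decreasing : ∀ {r c c' a b} → c < c' → T [ r , c ]= a → T [ r , c' ]= b → b < a
  row-decreasing {r} {c} {c'} c<c' p q with <⇒≡suc+ c<c'
  ... | d , refl = go d p q
    where
    go : ∀ {a b} d → T [ r , c ]= a → T [ r , suc (d + c) ]= b → b < a
    go zero    p q = rowDec sct r c _ _ (entry≡ p) (entry≡ q)
    go (suc d) p q with at-left (≤-trans (at-col-pos p) (m≤n⇒m≤1+n (m≤n+m c d))) q
    ... | _ , q' = <-trans (rowDec sct r _ _ _ (entry≡ q') (entry≡ q)) (go d p q')

  -- An entry strictly between the two would have a value strictly between i and i + 1.
  same-row-successor : ∀ {r c c' i} → T [ r , c ]= i → T [ r , c' ]= suc i → c ≡ suc c'
  same-row-successor {r} {c} {c'} {i} p q with <-cmp c (suc c')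
  ... | tri≈ _ e _ = e
  ... | tri< l _ _ with m≤n⇒m<n∨m≡n (m<1+n⇒m≤n l)
  ...   | inj₁ l' = ⊥-elim (<-asym (row-decreasing l' p q) (n<1+n i))
  ...   | inj₂ refl = ⊥-elim (1+n≢n (at-unique q p))
  same-row-successor {r} {c} {c'} {i} p q | tri> _ _ l
    with at-between (c ∸ suc c') (subst (λ x → T [ r , x ]= i) (sym (m∸n+n≡m (<⇒≤ l))) p) (s≤s z≤n)
  ... | v , s = ⊥-elim (<-irrefl refl (<-≤-trans (row-decreasing l s p) (m<1+n⇒m≤n (row-decreasing (n<1+n c') q s))))

sᵢ-injective : ∀ i {T} → Injective T → Injective (sᵢ i T)
sᵢ-injective i inj p q with at-map⁻ p | at-map⁻ q
... | a , p' , e | b , q' , e' = inj p' (subst (_ [ _ , _ ]=_) (swap-injective i (trans (sym e') e)) q')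

-- `∼` compares entries of one column only, and i and i + 1 lie in different columns.
sᵢ-∼ : ∀ {T i r c r' c'} → Injective T → T [ r , c ]= i → T [ r' , c' ]= suc i → ¬ c ≡ c' → sᵢ i T ∼ T
sᵢ-∼ {T} {i} {c = c} {c' = c'} inj pi pi' c≢c' r₁ r₂ k a b a' b' p q p' q'
  with at-map⁻ (at {sᵢ i T} {r₁} {k} p) | at-map⁻ (at {sᵢ i T} {r₂} {k} q)
... | x , px , refl | y , py , refl
  with at-unique px (at p') | at-unique py (at q')
... | refl | refl = mk⇔ to λ l → swap-mono i l (different px py)
  where
  different : ∀ {r₁ r₂ a b} → T [ r₁ , k ]= a → T [ r₂ , k ]= b → ¬ (a ≡ i × b ≡ suc i)
  different px py (refl , refl) =
    c≢c' (trans (,-injectiveʳ (inj pi px)) (sym (,-injectiveʳ (inj pi' py))))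
  to : swapEntry i x < swapEntry i y → x < y
  to l with <-cmp x y
  ... | tri< l' _ _ = l'
  ... | tri≈ _ refl _ = ⊥-elim (<-irrefl refl l)
  ... | tri> _ _ l' = ⊥-elim (<-asym l (swap-mono i l' (different py px)))

-- Different rows protect the row condition, different columns protect the first column and the
-- conclusion of the triple rule, and the last hypothesis protects the premise of the triple rule.
sᵢ-sct : ∀ {n α T i r c r' c'} → SCT n α T → T [ r , c ]= i → T [ r' , c' ]= suc i →
  ¬ c ≡ c' → ¬ r ≡ r' → ¬ (suc c ≡ c' × r < r') → SCT n α (sᵢ i T)
sᵢ-sct {n} {α} {T} {i} {r} {c} {r'} {c'} sct pi pi' c≢c' r≢r' safe = record
  { shape     = trans (sᵢ-shape i T) (shape sct)
  ; bijective = ↭-trans (↭-reflexive (concat-map T))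
                  (↭-trans (Perm.map⁺ (swapEntry i) (bijective sct))
                    (swap-↭ n i (proj₁ (at-bounds sct pi)) (proj₂ (at-bounds sct pi'))))
  ; rowDec    = λ r₁ k a b p q → rowDec' r₁ k (at p) (at q)
  ; colInc    = λ r₁ r₂ a b l p q → colInc' r₁ r₂ l (at p) (at q)
  ; triple    = λ r₁ r₂ k a b l p q b<a →
                  let v , s , lt = triple' r₁ r₂ k l (at p) (at q) b<a in v , entry≡ s , lt
  }
  where
  inj : Injective T
  inj = sct-injective sct

  cells : ∀ {r₁ c₁ r₂ c₂ a b} → T [ r₁ , c₁ ]= a → T [ r₂ , c₂ ]= b → a ≡ i × b ≡ suc i →
    (r , c) ≡ (r₁ , c₁) × (r' , c') ≡ (r₂ , c₂)
  cells px py (refl , refl) = inj pi px , inj pi' py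

  rowDec' : ∀ r₁ k {a b} → sᵢ i T [ r₁ , k ]= a → sᵢ i T [ r₁ , suc k ]= b → b < a
  rowDec' r₁ k p q with at-map⁻ p | at-map⁻ q
  ... | x , px , refl | y , py , refl =
    swap-mono i (rowDec sct r₁ k x y (entry≡ px) (entry≡ py)) λ e →
      let u , v = cells py px e in r≢r' (trans (,-injectiveˡ u) (sym (,-injectiveˡ v)))

  sameColumn : ∀ {r₁ r₂ k x y} → T [ r₁ , k ]= x → T [ r₂ , k ]= y → x < y → swapEntry i x < swapEntry i y
  sameColumn px py l = swap-mono i l λ e →
    let u , v = cells px py e in c≢c' (trans (,-injectiveʳ u) (sym (,-injectiveʳ v)))

  colInc' : ∀ r₁ r₂ {a b} → r₁ < r₂ → sᵢ i T [ r₁ , 1 ]= a → sᵢ i T [ r₂ , 1 ]= b → a < b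
  colInc' r₁ r₂ l p q with at-map⁻ p | at-map⁻ q
  ... | x , px , refl | y , py , refl =
    sameColumn px py (colInc sct r₁ r₂ x y l (entry≡ px) (entry≡ py))

  triple' : ∀ r₁ r₂ k {a b} → r₁ < r₂ → sᵢ i T [ r₂ , suc k ]= b → sᵢ i T [ r₁ , k ]= a → b < a →
    ∃ λ v → sᵢ i T [ r₁ , suc k ]= v × b < v
  triple' r₁ r₂ k l p q b<a with at-map⁻ p | at-map⁻ q
  ... | y , py , refl | x , px , refl with <-cmp y x
  ...   | tri< y<x _ _ = let v , s , lt = triple sct r₁ r₂ k x y l (entry≡ py) (entry≡ px) y<x
                         in swapEntry i v , at-map⁺ (at s) , sameColumn py (at {T} {r₁} s) lt
  ...   | tri≈ _ refl _ = ⊥-elim (<-irrefl refl b<a)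
  -- Here the swap would have created the premise, so the two entries are i and i + 1 and i attacks
  -- i + 1, which `safe` excludes.
  ...   | tri> _ _ x<y = ⊥-elim (<-asym b<a (swap-mono i x<y λ e →
            let u , v = cells px py e in
            safe (trans (cong suc (,-injectiveʳ u)) (sym (,-injectiveʳ v)) ,
                  subst₂ _<_ (sym (,-injectiveˡ u)) (sym (,-injectiveˡ v)) l)))

-- The operators π_i on tableaux, with `nothing` for the zero vector

act : ℕ → Tableau → Maybe Tableau
act i T = if not (inD T i) then just T else (if attacksNext T i then nothing else just (sᵢ i T))

-- The cells of i and i + 1 when i is in nAD: distinct cells of one column already attack each
-- other, so a nonattacking descent has c < c'.
Safe : ℕ × ℕ → ℕ × ℕ → Set
Safe (r , c) (r' , c') = c < c' × ¬ (suc c ≡ c' × r < r')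

data ActView (T : Tableau) (p q : ℕ × ℕ) (i : ℕ) : Maybe Tableau → Set where
  stay : proj₂ q < proj₂ p → ActView T p q i (just T)
  kill : proj₂ p ≤ proj₂ q → ¬ Safe p q → ActView T p q i nothing
  move : Safe p q → ActView T p q i (just (sᵢ i T))

attack-unsafe : ∀ p q → cellAttacks p q ≡ true → ¬ Safe p q
attack-unsafe (r , c) (r' , c') e (c<c' , h) rewrite ≡ᵇ-false (<⇒≢ c<c') with suc c ≡ᵇ c' in e₁ | r <ᵇ r' in e₂
attack-unsafe (r , c) (r' , c') e  (c<c' , h) | true | true =
  h (≡ᵇ-sound e₁ , <ᵇ⇒< r r' (subst T (sym e₂) _))
attack-unsafe (r , c) (r' , c') () (c<c' , h) | true  | false
attack-unsafe (r , c) (r' , c') () (c<c' , h) | false | _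

attack-safe : ∀ p q → ¬ p ≡ q → proj₂ p ≤ proj₂ q → cellAttacks p q ≡ false → Safe p q
attack-safe (r , c) (r' , c') p≢q c≤c' e with c ≟ c'
... | yes refl rewrite ≡ᵇ-true {c} refl with r ≟ r'
...   | yes refl = ⊥-elim (p≢q refl)
...   | no r≢r' rewrite ≡ᵇ-false r≢r' with e
...     | ()
attack-safe (r , c) (r' , c') p≢q c≤c' e | no c≢c' rewrite ≡ᵇ-false c≢c' = ≤∧≢⇒< c≤c' c≢c' , unattacked
  where
  unattacked : ¬ (suc c ≡ c' × r < r')
  unattacked (refl , l) with trans (sym e) (cong₂ _∧_ (≡ᵇ-true {suc c} refl) (dec-true (r <? r') l))
  ... | ()

actView : ∀ {T i p q} → Injective T → T [ proj₁ p , proj₂ p ]= i → T [ proj₁ q , proj₂ q ]= suc i →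
  ActView T p q i (act i T)
actView {T} {i} {p} {q} inj pi pi' rewrite inD-at inj pi pi' | attacksNext-at inj pi pi'
  with proj₂ p ≤? proj₂ q
... | no c≰c' rewrite dec-false (proj₂ p ≤? proj₂ q) c≰c' = stay (≰⇒> c≰c')
... | yes c≤c' rewrite dec-true (proj₂ p ≤? proj₂ q) c≤c' with cellAttacks p q in eq
...   | true  = kill c≤c' (attack-unsafe p q eq)
...   | false = move (attack-safe p q (λ { refl → 1+n≢n (at-unique pi' pi) }) c≤c' eq)

act-move : ∀ {T i r c r' c'} → Injective T → T [ r , c ]= i → T [ r' , c' ]= suc i →
  Safe (r , c) (r' , c') → act i T ≡ just (sᵢ i T)
act-move {T} {i} inj p q s with act i T | actView inj p q
... | _ | stay l   = ⊥-elim (<-asym l (proj₁ s))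
... | _ | kill _ h = ⊥-elim (h s)
... | _ | move _   = refl

actWord : List ℕ → Tableau → Maybe Tableau
actWord []      T = just T
actWord (i ∷ w) T = actWord w T >>= act i

-- A weight for sorting tableaux

psum : (ℕ → ℕ) → ℕ → ℕ
psum g zero    = 0
psum g (suc N) = psum g N + g N

-- Writing the weighted sum of (N - k) g(k) as a sum of prefix sums turns an exchange of two
-- adjacent values into a change of a single prefix sum, the one that ends between them.
wsum : (ℕ → ℕ) → ℕ → ℕ
wsum g zero    = 0
wsum g (suc N) = wsum g N + psum g (suc N)

module _ {g g' : ℕ → ℕ} {i : ℕ} (e₀ : g' i ≡ g (suc i)) (e₁ : g' (suc i) ≡ g i)
  (e : ∀ k → ¬ k ≡ i → ¬ k ≡ suc i → g' k ≡ g k) (l : g (suc i) < g i) where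

  psum-below : ∀ N → N ≤ i → psum g' N ≡ psum g N
  psum-below zero    _  = refl
  psum-below (suc N) le = cong₂ _+_ (psum-below N (<⇒≤ le)) (e N (<⇒≢ le) (<⇒≢ (m<n⇒m<1+n le)))

  psum-at : psum g' (suc i) < psum g (suc i)
  psum-at = subst₂ (λ x y → x + y < psum g (suc i)) (sym (psum-below i ≤-refl)) (sym e₀) (+-monoʳ-< (psum g i) l)

  psum-above : ∀ d → psum g' (suc (suc (d + i))) ≡ psum g (suc (suc (d + i)))
  psum-above zero = begin
    psum g' i + g' i + g' (suc i)  ≡⟨ cong₂ _+_ (cong₂ _+_ (psum-below i ≤-refl) e₀) e₁ ⟩
    psum g i + g (suc i) + g i     ≡⟨ +-assoc (psum g i) _ _ ⟩
    psum g i + (g (suc i) + g i)   ≡⟨ cong (psum g i +_) (+-comm (g (suc i)) (g i)) ⟩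
    psum g i + (g i + g (suc i))   ≡⟨ +-assoc (psum g i) _ _ ⟨
    psum g i + g i + g (suc i)     ∎
    where open ≡-Reasoning
  psum-above (suc d) = cong₂ _+_ (psum-above d)
    (e (suc (suc (d + i))) (<⇒≢ (m≤n⇒m≤1+n (s≤s (m≤n+m i d))) ∘ sym) (<⇒≢ (s≤s (s≤s (m≤n+m i d))) ∘ sym))

  wsum-below : ∀ N → N ≤ i → wsum g' N ≡ wsum g N
  wsum-below zero    _  = refl
  wsum-below (suc N) le = cong₂ _+_ (wsum-below N (<⇒≤ le)) (psum-below (suc N) le)

  wsum-decreasing : ∀ d → wsum g' (suc (d + i)) < wsum g (suc (d + i))
  wsum-decreasing zero    = +-mono-≤-< (≤-reflexive (wsum-below i ≤-refl)) psum-at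
  wsum-decreasing (suc d) = +-mono-<-≤ (wsum-decreasing d) (≤-reflexive (psum-above d))

-- Columns are numbered from 1; the default 0 belongs to numbers that are not entries.
colOf : Tableau → ℕ → ℕ
colOf T k = maybe proj₂ 0 (pos T k)

colOf-at : ∀ {T r c k} → Injective T → T [ r , c ]= k → colOf T k ≡ c
colOf-at inj p = cong (maybe proj₂ 0) (at⇒pos inj p)

colOf-sᵢ : ∀ {T i k} → Injective T → ¬ k ≡ i → ¬ k ≡ suc i → colOf (sᵢ i T) k ≡ colOf T k
colOf-sᵢ {T} {i} {k} inj k≢i k≢si with pos T k in eq
... | just (r , c) with posFrom-sound k T 1 eq
...   | j , refl , p rewrite +-comm j 1 =
        colOf-at (sᵢ-injective i inj) (subst (sᵢ i T [ suc j , c ]=_) (swap-other k≢i k≢si) (at-map⁺ p))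
colOf-sᵢ {T} {i} {k} inj k≢i k≢si | nothing with pos (sᵢ i T) k in eq'
... | nothing = refl
... | just (r , c) with posFrom-sound k (sᵢ i T) 1 eq'
...   | j , _ , p with at-map⁻ p
...     | b , q , e = ⊥-elim (posFrom-complete 1 (subst (T [ suc j , c ]=_) b≡k q) eq)
  where
  b≡k : b ≡ k
  b≡k = trans (sym (swap-involutive i b)) (trans (cong (swapEntry i) (sym e)) (swap-other k≢i k≢si))

-- Source tableaux

IsSource : Tableau → Set
IsSource T = ∀ {i r c r' c'} → T [ r , c ]= i → T [ r' , c' ]= suc i → c' < c → r ≡ r' × c ≡ suc c'

-- Σ_k (n + 1 - k) · (column of k)
weight : ℕ → Tableau → ℕ
weight n T = wsum (colOf T ∘ suc) n

-- The coefficient of i in the weight exceeds that of i + 1 by 1, and the swap gives the smaller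
-- column number to i.
weight-sᵢ : ∀ {n α T i r c r' c'} → SCT n α T → T [ r , c ]= i → T [ r' , c' ]= suc i → c' < c →
  weight n (sᵢ i T) < weight n T
weight-sᵢ {i = zero} sct p q l = ⊥-elim (<⇒≢ (proj₁ (at-bounds sct p)) refl)
weight-sᵢ {n} {T = T} {suc i} sct p q l = subst (λ N → weight N (sᵢ (suc i) T) < weight N T)
  (trans (sym (+-suc (n ∸ suc i) i)) (m∸n+n≡m (<⇒≤ (proj₂ (at-bounds sct q)))))
  (wsum-decreasing
    (trans (colOf-at inj' (subst (sᵢ (suc i) T [ _ , _ ]=_) (swap-high (suc i)) (at-map⁺ q))) (sym (colOf-at inj q)))
    (trans (colOf-at inj' (subst (sᵢ (suc i) T [ _ , _ ]=_) (swap-low (suc i)) (at-map⁺ p))) (sym (colOf-at inj p)))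
    (λ k h h' → colOf-sᵢ inj (h ∘ suc-injective) (h' ∘ suc-injective))
    (subst₂ _<_ (sym (colOf-at inj q)) (sym (colOf-at inj p)) l) (n ∸ suc i))
  where
  inj : Injective T
  inj = sct-injective sct
  inj' : Injective (sᵢ (suc i) T)
  inj' = sᵢ-injective (suc i) inj

-- An obstruction to being a source. Different rows express that i + 1 is not the left neighbour of
-- i, since by `same-row-successor` it can be nothing else within the row.
record Unsorted (T : Tableau) : Set where
  constructor unsorted
  field
    {i r c r' c'} : ℕ
    at₀    : T [ r , c ]= i
    at₁    : T [ r' , c' ]= suc i
    left   : c' < c
    rows   : ¬ r ≡ r'

source? : ∀ {n α T} → SCT n α T → IsSource T ⊎ Unsorted T
source? {n} {α} {T} sct with search n
  where
  OK : ℕ → Set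
  OK i = ∀ {r c r' c'} → T [ r , c ]= i → T [ r' , c' ]= suc i → c' < c → r ≡ r' × c ≡ suc c'

  inj : Injective T
  inj = sct-injective sct

  test : ∀ i → OK i ⊎ Unsorted T
  test i with 1 ≤? i | suc i ≤? n
  ... | no i≱1 | _      = inj₁ λ p _ _ → ⊥-elim (i≱1 (proj₁ (at-bounds sct p)))
  ... | yes _  | no i≮n = inj₁ λ _ q _ → ⊥-elim (i≮n (proj₂ (at-bounds sct q)))
  ... | yes 1≤i | yes i<n with locate sct 1≤i (<⇒≤ i<n) | locate sct (s≤s z≤n) i<n
  ...   | r , c , p | r' , c' , q with c' <? c
  ...     | no c'≮c = inj₁ λ p' q' l →
              ⊥-elim (c'≮c (subst₂ _<_ (,-injectiveʳ (inj q' q)) (,-injectiveʳ (inj p' p)) l))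
  ...     | yes c'<c with r ≟ r'
  ...       | no r≢r' = inj₂ (unsorted p q c'<c r≢r')
  ...       | yes refl = inj₁ λ p' q' _ →
                trans (,-injectiveˡ (inj p' p)) (sym (,-injectiveˡ (inj q' q))) ,
                trans (,-injectiveʳ (inj p' p))
                  (trans (same-row-successor sct p q) (cong suc (sym (,-injectiveʳ (inj q' q)))))

  search : ∀ k → (∀ i → i < k → OK i) ⊎ Unsorted T
  search zero = inj₁ λ _ ()
  search (suc k) with test k | search k
  ... | inj₂ v | _      = inj₂ v
  ... | inj₁ _ | inj₂ v = inj₂ v
  ... | inj₁ t | inj₁ s = inj₁ λ i l → [ (λ l' → s i l') , (λ { refl → t }) ]′ (m≤n⇒m<n∨m≡n (m<1+n⇒m≤n l))
... | inj₂ v = inj₂ v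
... | inj₁ s = inj₁ λ p q → s _ (proj₂ (at-bounds sct q)) p q

-- `∼` says nothing about cells missing from one of its arguments, so the middle tableau must have
-- the shape of the first in order to link the two comparisons.
∼-trans : ∀ {T U V} → map length T ≡ map length U → T ∼ U → U ∼ V → T ∼ V
∼-trans {T} {U} e h h' r r' k a b a'' b'' p q p'' q''
  with at-shape {T} {U} {r} {k} e (at p) | at-shape {T} {U} {r'} {k} e (at q)
... | a' , at p' | b' , at q' =
  mk⇔ (Equivalence.to (h' r r' k a' b' a'' b'' p' q' p'' q'') ∘ Equivalence.to (h r r' k a b a' b' p q p' q'))
      (Equivalence.from (h r r' k a b a' b' p q p' q') ∘ Equivalence.from (h' r r' k a' b' a'' b'' p' q' p'' q''))

-- Words that push one entry upwards

least : ∀ {P : ℕ → Set} → (∀ j → Dec (P j)) → ∀ e → P e → ∃ λ d → d ≤ e × P d × (∀ j → j < d → ¬ P j)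
least P? zero    pe = 0 , z≤n , pe , λ _ ()
least P? (suc e) pe with P? 0
... | yes p₀ = 0 , z≤n , p₀ , λ _ ()
... | no ¬p₀ with least (P? ∘ suc) e pe
...   | d , l , pd , below = suc d , s≤s l , pd , λ { zero _ → ¬p₀ ; (suc j) (s≤s l') → below j l' }

-- The word of π_{m+d-1} ⋯ π_{m+1} π_m; in actWord the head of a word acts last.
pushWord : ℕ → ℕ → List ℕ
pushWord m zero    = []
pushWord m (suc d) = d + m ∷ pushWord m d

-- The value of the word when every letter moves: the cell of m receives d + m, and each of m + 1,
-- ..., m + d drops by 1.
push : ℕ → ℕ → Tableau → Tableau
push m zero    T = T
push m (suc d) T = sᵢ (d + m) (push m d T)

push-injective : ∀ {T} m d → Injective T → Injective (push m d T)
push-injective m zero    inj = inj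
push-injective m (suc d) inj = sᵢ-injective (d + m) (push-injective m d inj)

push-cancel : ∀ {T T'} m d → push m d T ≡ push m d T' → T ≡ T'
push-cancel m zero    e = e
push-cancel m (suc d) e = push-cancel m d
  (trans (sym (sᵢ-involutive (d + m) _)) (trans (cong (sᵢ (d + m)) e) (sᵢ-involutive (d + m) _)))

push-at : ∀ {T m r c} d → T [ r , c ]= m → push m d T [ r , c ]= d + m
push-at zero    p = p
push-at {T} {m} (suc d) p = subst (push m (suc d) T [ _ , _ ]=_) (swap-low (d + m)) (at-map⁺ (push-at d p))

push-above : ∀ {T m k r c} d → d + m < k → T [ r , c ]= k → push m d T [ r , c ]= k
push-above zero    l p = p
push-above {T} {m} (suc d) l p = subst (push m (suc d) T [ _ , _ ]=_) (swap-other (<⇒≢ (<⇒≤ l) ∘ sym) (<⇒≢ l ∘ sym))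
  (at-map⁺ (push-above d (<⇒≤ l) p))

-- When the letter j + m acts, the original cell of m holds j + m, and the entry j + m + 1 has not
-- moved yet. So cells of the initial tableau decide what each letter does.
push-survives : ∀ {T m r c} d → Injective T → T [ r , c ]= m →
  (∀ j → j < d → ∃₂ λ r' c' → T [ r' , c' ]= suc (j + m) × Safe (r , c) (r' , c')) →
  actWord (pushWord m d) T ≡ just (push m d T)
push-survives zero inj p h = refl
push-survives {m = m} (suc d) inj p h
  rewrite push-survives d inj p (λ j l → h j (m<n⇒m<1+n l)) with h d (n<1+n d)
... | _ , _ , q , s = act-move (push-injective m d inj) (push-at d p) (push-above d ≤-refl q) s

-- Entries weakly right of m make every letter a descent, so no letter can fix the tableau: it moves
-- it or gives zero.
push-run : ∀ {T m r c} d → Injective T → T [ r , c ]= m →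
  (∀ j → j < d → ∃₂ λ r' c' → T [ r' , c' ]= suc (j + m) × c ≤ c') →
  actWord (pushWord m d) T ≡ nothing ⊎ actWord (pushWord m d) T ≡ just (push m d T)
push-run zero inj p h = inj₂ refl
push-run {T} {m} (suc d) inj p h with push-run d inj p (λ j l → h j (m<n⇒m<1+n l)) | h d (n<1+n d)
... | inj₁ e | _ rewrite e = inj₁ refl
... | inj₂ e | _ , _ , q , c≤c' rewrite e
  with act (d + m) (push m d T) | actView (push-injective m d inj) (push-at d p) (push-above d ≤-refl q)
...   | _ | stay l   = ⊥-elim (<⇒≱ l c≤c')
...   | _ | kill _ _ = inj₁ refl
...   | _ | move _   = inj₂ refl

-- If the word has not vanished before, its last letter meets two consecutive entries in one column,
-- which attack each other.
push-killed : ∀ {T m r c r'} d → Injective T → T [ r , c ]= m →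
  (∀ j → j < d → ∃₂ λ r' c' → T [ r' , c' ]= suc (j + m) × c ≤ c') → T [ r' , c ]= suc (d + m) →
  actWord (pushWord m (suc d)) T ≡ nothing
push-killed {T} {m} d inj p h q with push-run d inj p h
... | inj₁ e rewrite e = refl
... | inj₂ e rewrite e
  with act (d + m) (push m d T) | actView (push-injective m d inj) (push-at d p) (push-above d ≤-refl q)
...   | _ | stay l   = ⊥-elim (<-irrefl refl l)
...   | _ | kill _ _ = refl
...   | _ | move s   = ⊥-elim (<-irrefl refl (proj₁ s))

pushWord-letters : ∀ {n m} d → 1 ≤ m → d + m ≤ n → All (λ i → 1 ≤ i × i < n) (pushWord m d)
pushWord-letters zero    l l' = []
pushWord-letters (suc d) l l' = (≤-trans l (m≤n+m _ d) , l') ∷ pushWord-letters d l (<⇒≤ l')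

-- The equivalence class and its source

record LargestDiff (S T : Tableau) (m : ℕ) : Set where
  constructor diff
  field
    {r c r₁ c₁} : ℕ
    atS   : S [ r , c ]= m
    atT   : T [ r₁ , c₁ ]= m
    apart : ¬ (r , c) ≡ (r₁ , c₁)
    agree : ∀ {k r c} → m < k → S [ r , c ]= k → T [ r , c ]= k

module Class {n : ℕ} {α : List ℕ} {T₀ : Tableau} (sct₀ : SCT n α T₀) where

  InClass : Tableau → Set
  InClass T = SCT n α T × T ∼ T₀

  Letter : ℕ → Set
  Letter i = 1 ≤ i × i < n

  class-injective : ∀ {T} → InClass T → Injective T
  class-injective (s , _) = sct-injective s

  class-sᵢ : ∀ {T i r c r' c'} → InClass T → T [ r , c ]= i → T [ r' , c' ]= suc i →
    ¬ c ≡ c' → ¬ r ≡ r' → ¬ (suc c ≡ c' × r < r') → InClass (sᵢ i T)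
  class-sᵢ {T} {i} (s , o) p q h h' h'' =
    sᵢ-sct s p q h h' h'' , ∼-trans {sᵢ i T} {T} {T₀} (sᵢ-shape i T) (sᵢ-∼ (sct-injective s) p q h) o

  move-class : ∀ {T i r c r' c'} → InClass T → T [ r , c ]= i → T [ r' , c' ]= suc i →
    Safe (r , c) (r' , c') → InClass (sᵢ i T)
  move-class {i = i} t p q (c<c' , h) =
    class-sᵢ t p q (<⇒≢ c<c') (λ { refl → <-asym (row-decreasing (proj₁ t) c<c' p q) (n<1+n i) }) h

  act-class : ∀ {T U i} → InClass T → Letter i → act i T ≡ just U → InClass U
  act-class {T} {U} {i} t (1≤i , i<n) e
    with locate (proj₁ t) 1≤i (<⇒≤ i<n) | locate (proj₁ t) (s≤s z≤n) i<n
  ... | r , c , p | r' , c' , q with act i T | actView (class-injective t) p q | e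
  ...   | _ | stay _ | refl = t
  ...   | _ | move s | refl = move-class t p q s

  actWord-class : ∀ {T U w} → InClass T → All Letter w → actWord w T ≡ just U → InClass U
  actWord-class t [] refl = t
  actWord-class {T} {w = i ∷ w} t (l ∷ ls) e with actWord w T in eq
  ... | just V = act-class (actWord-class t ls eq) l e

  -- Swapping an unsorted pair lowers the weight, and π_i leads back from the swapped tableau to T.
  -- Hence the recursion ends in a source, and the letters collected on the way recover T from it.
  toSource : ∀ {T} → InClass T →
    ∃₂ λ S w → InClass S × IsSource S × All Letter w × actWord w S ≡ just T
  toSource {T} t = go t (<-wellFounded (weight n T))
    where
    go : ∀ {T} → InClass T → Acc _<_ (weight n T) →
      ∃₂ λ S w → InClass S × IsSource S × All Letter w × actWord w S ≡ just T
    go {T} t (acc rec) with source? (proj₁ t)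
    ... | inj₁ src = T , [] , t , src , [] , refl
    ... | inj₂ (unsorted {i} {r} {c} {r'} {c'} p q l r≢r') =
      let safe = λ { (e , _) → <-asym (subst (c <_) e (n<1+n c)) l }
          t' = class-sᵢ t p q (<⇒≢ l ∘ sym) r≢r' safe
          S , w , s , src , letters , e = go t' (rec (weight-sᵢ (proj₁ t) p q l))
          move-back = act-move (class-injective t')
            (subst (sᵢ i T [ r' , c' ]=_) (swap-high i) (at-map⁺ q))
            (subst (sᵢ i T [ r , c ]=_) (swap-low i) (at-map⁺ p))
            (l , λ { (refl , r'<r) → unattacked t p q r'<r })
      in S , i ∷ w , s , src ,
         (proj₁ (at-bounds (proj₁ t) p) , proj₂ (at-bounds (proj₁ t) q)) ∷ letters ,
         trans (cong (_>>= act i) e) (trans move-back (cong just (sᵢ-involutive i T)))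
      where
      -- The triple rule would put an entry strictly between i and i + 1.
      unattacked : ∀ {T i r r' c'} → InClass T → T [ r , suc c' ]= i → T [ r' , c' ]= suc i → ¬ r' < r
      unattacked {i = i} {r} {r'} {c'} (s , _) p q l
        with triple s r' r c' (suc i) i l (entry≡ p) (entry≡ q) (n<1+n i)
      ... | v , e , i<v = <⇒≱ i<v (m<1+n⇒m≤n (rowDec s r' c' _ _ (entry≡ q) e))

  class-cell : ∀ {T T' r c a} → InClass T → InClass T' → T [ r , c ]= a → ∃ λ b → T' [ r , c ]= b
  class-cell (s , _) (s' , _) = at-shape (trans (shape s) (sym (shape s')))

  class-order : ∀ {T T' r r' k a b a' b'} → InClass T → InClass T' →
    T [ r , k ]= a → T [ r' , k ]= b → T' [ r , k ]= a' → T' [ r' , k ]= b' → a < b → a' < b'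
  class-order {r = r} {r'} {k} (s , o) (s' , o') p q p' q' l
    with at-shape (trans (shape s) (sym (shape sct₀))) p | at-shape (trans (shape s) (sym (shape sct₀))) q
  ... | _ , p₀ | _ , q₀ =
    Equivalence.from (o' r r' k _ _ _ _ (entry≡ p') (entry≡ q') (entry≡ p₀) (entry≡ q₀))
      (Equivalence.to (o r r' k _ _ _ _ (entry≡ p) (entry≡ q) (entry≡ p₀) (entry≡ q₀)) l)

  -- Reading S from v upwards, columns decrease only by steps to the left neighbour, so every column
  -- between those of v and b is visited; row and column comparisons along the way also hold in T.
  source-inversion : ∀ {S T} → IsSource S → InClass S → InClass T → ∀ {v b rv cv rb cb tv tb} →
    S [ rv , cv ]= v → S [ rb , cb ]= b → v < b → cb < cv → T [ rv , cv ]= tv → T [ rb , cb ]= tb → tv < tb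
  source-inversion {S} {T} src s t pv pb v<b cb<cv qv qb with <⇒≡suc+ v<b
  ... | d , b≡ = walk d pv pv ≤-refl ≤-refl pb b≡ cb<cv qv qb
    where
    walk : ∀ d {v a b rv cv ra ca rb cb tv tb} → S [ rv , cv ]= v → S [ ra , ca ]= a → v ≤ a → cv ≤ ca →
      S [ rb , cb ]= b → b ≡ suc (d + a) → cb < cv → T [ rv , cv ]= tv → T [ rb , cb ]= tb → tv < tb
    walk d {v} {a} {b} {rv} {cv} {ra} {ca} {rb} {cb} {tv} {tb} pv pa v≤a cv≤ca pb refl cb<cv qv qb
      with locate (proj₁ s) {suc a} (s≤s z≤n) (≤-trans (s≤s (m≤n+m a d)) (proj₂ (at-bounds (proj₁ s) pb)))
    ... | r' , c' , p' with cv ≤? c'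
    walk zero pv pa v≤a cv≤ca pb refl cb<cv qv qb | r' , c' , p' | yes cv≤c' =
      ⊥-elim (<⇒≱ cb<cv (subst (_ ≤_) (,-injectiveʳ (class-injective s p' pb)) cv≤c'))
    walk (suc d) {a = a} pv pa v≤a cv≤ca pb refl cb<cv qv qb | r' , c' , p' | yes cv≤c' =
      walk d pv p' (m≤n⇒m≤1+n v≤a) cv≤c' pb (cong suc (sym (+-suc d a))) cb<cv qv qb
    -- The walk first drops below column cv here. A source steps left by one column, so a is in
    -- column cv itself, and tv ≤ ta < t' ≤ tb follows from column, row and the rest of the walk.
    ... | no cv≰c' with src pa p' (<-≤-trans (≰⇒> cv≰c') cv≤ca)
    ...   | refl , refl with ≤-antisym cv≤ca (≰⇒> cv≰c')
    ...     | refl with class-cell s t pa | class-cell s t p'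
    ...       | ta , qa | t' , q' =
      ≤-<-trans tv≤ta (<-≤-trans (row-decreasing (proj₁ t) (n<1+n c') q' qa) (t'≤tb d pb refl))
      where
      tv≤ta : tv ≤ ta
      tv≤ta with m≤n⇒m<n∨m≡n v≤a
      ... | inj₁ v<a  = <⇒≤ (class-order s t pv pa qv qa v<a)
      ... | inj₂ refl = ≤-reflexive (at-unique qv
        (subst (λ z → T [ proj₁ z , proj₂ z ]= ta) (class-injective s pa pv) qa))

      t'≤tb : ∀ d {b} → S [ rb , cb ]= b → b ≡ suc (d + a) → t' ≤ tb
      t'≤tb zero    pb refl =
        ≤-reflexive (at-unique q' (subst (λ z → T [ proj₁ z , proj₂ z ]= tb) (class-injective s pb p') qb))
      t'≤tb (suc d) pb refl with m≤n⇒m<n∨m≡n (m<1+n⇒m≤n cb<cv)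
      ... | inj₂ refl  = <⇒≤ (class-order s t p' pb q' qb (s≤s (s≤s (m≤n+m a d))))
      ... | inj₁ cb<c' = <⇒≤ (walk d p' p' ≤-refl ≤-refl pb (cong suc (sym (+-suc d a))) cb<c' q' qb)

  agree⁻¹ : ∀ {S T m} → InClass S → InClass T → (∀ {k r c} → m < k → S [ r , c ]= k → T [ r , c ]= k) →
    ∀ {k r c} → m < k → T [ r , c ]= k → S [ r , c ]= k
  agree⁻¹ {S} s t agree {k} l q with locate (proj₁ s) (≤-trans (s≤s z≤n) l) (proj₂ (at-bounds (proj₁ t) q))
  ... | _ , _ , p = subst (λ z → S [ proj₁ z , proj₂ z ]= k) (class-injective t (agree l p) q) p

  diff-sym : ∀ {S T m} → InClass S → InClass T → LargestDiff S T m → LargestDiff T S m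
  diff-sym s t (diff p q h agree) = diff q p (h ∘ sym) (agree⁻¹ s t agree)

  -- Entries above m occupy the same cells in both tableaux, so none of them can sit where the other
  -- tableau has m.
  diff-smaller : ∀ {S T m} → InClass S → InClass T → (δ : LargestDiff S T m) → let open LargestDiff δ in
    ∀ {p} → S [ r₁ , c₁ ]= p → p < m
  diff-smaller {m = m} s t (diff atS atT apart agree) {p} q with <-cmp p m
  ... | tri< l _ _    = l
  ... | tri≈ _ refl _ = ⊥-elim (apart (class-injective s atS q))
  ... | tri> _ _ l    = ⊥-elim (<⇒≢ l (at-unique atT (agree l q)))

  diff-moves-left : ∀ {S T m} → IsSource S → InClass S → InClass T → (δ : LargestDiff S T m) → LargestDiff.c₁ δ < LargestDiff.c δ
  diff-moves-left src s t δ with class-cell t s (LargestDiff.atT δ) | class-cell s t (LargestDiff.atS δ)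
  ... | p , pS | p' , pT with diff-smaller s t δ pS | diff-smaller t s (diff-sym s t δ) pT
  ...   | p<m | p'<m with <-cmp (LargestDiff.c₁ δ) (LargestDiff.c δ)
  ...     | tri< l _ _    = l
  diff-moves-left src s t (diff atS atT _ _) | p , pS | p' , pT | p<m | p'<m | tri≈ _ refl _ =
    ⊥-elim (<-asym p'<m (class-order s t pS atS atT pT p<m))
  -- `source-inversion` with p as v and m as b would give m < p'.
  diff-moves-left src s t (diff atS atT _ _) | p , pS | p' , pT | p<m | p'<m | tri> _ _ l =
    ⊥-elim (<-asym p'<m (source-inversion src s t pS atS p<m l atT pT))

  equal-or-diff : ∀ {S T} → InClass S → InClass T → S ≡ T ⊎ ∃ λ m → LargestDiff S T m
  equal-or-diff {S} {T} s t = scan n ≤-refl λ l p → ⊥-elim (<⇒≱ l (proj₂ (at-bounds (proj₁ s) p)))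
    where
    scan : ∀ m → m ≤ n → (∀ {k r c} → m < k → S [ r , c ]= k → T [ r , c ]= k) → S ≡ T ⊎ ∃ λ m → LargestDiff S T m
    scan zero _ agree = inj₁ (at-ext S T (trans (shape (proj₁ s)) (sym (shape (proj₁ t))))
      λ p → agree (proj₁ (at-bounds (proj₁ s) p)) p)
    scan (suc m) l agree with locate (proj₁ s) (s≤s z≤n) l | locate (proj₁ t) (s≤s z≤n) l
    ... | r , c , p | r₁ , c₁ , q with ≡-dec _≟_ _≟_ (r , c) (r₁ , c₁)
    ...   | no apart = inj₂ (suc m , diff p q apart agree)
    ...   | yes refl = scan m (<⇒≤ l) agree'
      where
      agree' : ∀ {k r c} → m < k → S [ r , c ]= k → T [ r , c ]= k
      agree' m<k p' with m≤n⇒m<n∨m≡n m<k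
      ... | inj₁ l'   = agree l' p'
      ... | inj₂ refl = subst (λ z → T [ proj₁ z , proj₂ z ]= suc m) (class-injective s p p') q

  -- At the largest entry in which two sources differ, each would have it strictly further left than
  -- the other.
  source-unique : ∀ {S S'} → IsSource S → IsSource S' → InClass S → InClass S' → S ≡ S'
  source-unique src src' s s' with equal-or-diff s s'
  ... | inj₁ e = e
  ... | inj₂ (m , δ) = ⊥-elim (<-asym (diff-moves-left src s s' δ) (diff-moves-left src' s' s (diff-sym s s' δ)))

  -- q = d + m + 1 is the first entry above m in S that is not strictly to the right of m.
  record Separator (S T : Tableau) (m : ℕ) (δ : LargestDiff S T m) : Set where
    constructor separator
    open LargestDiff δ
    field
      {d r'}   : ℕ
      atq      : S [ r' , c ]= suc (d + m)
      right    : ∀ j → j < d → ∃₂ λ r' c' → S [ r' , c' ]= suc (j + m) × c < c'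
      survives : ∀ j → j < suc d → ∃₂ λ r' c' → S [ r' , c' ]= suc (j + m) × Safe (r₁ , c₁) (r' , c')

  separate : ∀ {S T m} → IsSource S → InClass S → InClass T → (δ : LargestDiff S T m) → let open LargestDiff δ in
    (∀ {r' c'} → S [ r' , c' ]= suc m → c' < c → c' < c₁) → Separator S T m δ
  separate src s t (diff {c = zero} atS _ _ _) _ = ⊥-elim (<⇒≢ (at-col-pos atS) refl)
  separate {S} {T} {m} src s t δ@(diff {r} {suc c} {r₁} {c₁} atS atT apart agree) nondescent
    with diff-moves-left src s t δ
  ... | s≤s c₁≤c with at-left (≤-trans (at-col-pos atT) c₁≤c) atS
  ...   | e , pe with <⇒≡suc+ (row-decreasing (proj₁ s) (n<1+n c) pe atS)
  ...     | o , refl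
    -- The left neighbour o + m + 1 of m meets the condition and so bounds the search.
    with least (λ j → colOf S (suc (j + m)) ≤? suc c) o
           (≤-trans (≤-reflexive (colOf-at (class-injective s) pe)) (n≤1+n c))
  ...       | d , d≤o , colOf≤ , below = separator atq right survives
    where
    inj : Injective S
    inj = class-injective s

    q : ℕ
    q = suc (d + m)

    q≤e : q ≤ suc (o + m)
    q≤e = s≤s (+-monoˡ-≤ m d≤o)

    cell : ∀ j → j < suc d → ∃₂ λ r' c' → S [ r' , c' ]= suc (j + m)
    cell j (s≤s l) = locate (proj₁ s) (s≤s z≤n)
      (≤-trans (≤-trans (s≤s (+-monoˡ-≤ m l)) q≤e) (proj₂ (at-bounds (proj₁ s) pe)))

    right : ∀ j → j < d → ∃₂ λ r' c' → S [ r' , c' ]= suc (j + m) × suc c < c'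
    right j l with cell j (m<n⇒m<1+n l)
    ... | r' , c' , p = r' , c' , p , ≰⇒> λ h → below j l (subst (_≤ suc c) (sym (colOf-at inj p)) h)

    rq cq : ℕ
    rq = proj₁ (cell d (n<1+n d))
    cq = proj₁ (proj₂ (cell d (n<1+n d)))

    atq' : S [ rq , cq ]= q
    atq' = proj₂ (proj₂ (cell d (n<1+n d)))

    cq≤ : cq ≤ suc c
    cq≤ = subst (_≤ suc c) (colOf-at inj atq') colOf≤

    -- `d` is generalised so that it can be split: for zero the predecessor of q is m and
    -- `nondescent` is required, otherwise it is an entry strictly right of m.
    cq≮ : ∀ d → S [ rq , cq ]= suc (d + m) → (∀ j → j < d → ∃₂ λ r' c' → S [ r' , c' ]= suc (j + m) × suc c < c') →
      ¬ cq < suc c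
    cq≮ zero p _ l = <⇒≱ (nondescent p l)
      (subst (c₁ ≤_) (suc-injective (proj₂ (src atS p l))) c₁≤c)
    cq≮ (suc d) p h l with h d (n<1+n d)
    ... | r'' , c'' , p'' , l'' = <⇒≱ l'' (subst (_≤ suc c) (sym (proj₂ (src p'' p (<-trans l l'')))) l)

    atq : S [ rq , suc c ]= q
    atq with m≤n⇒m<n∨m≡n cq≤
    ... | inj₁ l = ⊥-elim (cq≮ d atq' right l)
    ... | inj₂ e = subst (λ x → S [ rq , x ]= q) e atq'

    -- Compare the rows of m in S and T. If they are equal, p would be the left neighbour of m in S,
    -- yet smaller. If r < r₁, the triple rule in S, with q below the left neighbour of m, gives q <
    -- m. If r₁ < r, the triple rule in T puts an entry above p' to the right of m; by the column
    -- order the entry of S in that cell exceeds m, and p to its left would exceed m too.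
    unattacked : ¬ (suc c₁ ≡ suc c × r₁ < rq)
    unattacked (refl , r₁<rq) with class-cell t s atT | class-cell s t atS
    ... | p , pS | p' , pT with diff-smaller s t δ pS | diff-smaller t s (diff-sym s t δ) pT | <-cmp r r₁
    ...   | p<m | p'<m | tri≈ _ refl _ = <-asym p<m (row-decreasing (proj₁ s) (n<1+n c) pS atS)
    ...   | p<m | p'<m | tri< r<r₁ _ _
      with triple (proj₁ s) r rq c (suc (o + m)) q (<-trans r<r₁ r₁<rq) (entry≡ atq) (entry≡ pe)
             (≤∧≢⇒< q≤e λ e → 1+n≢n (,-injectiveʳ (inj (subst (S [ rq , suc c ]=_) e atq) pe)))
    ...     | v , ev , q<v = <⇒≱ q<v (≤-trans (≤-reflexive (at-unique (at ev) atS)) (m≤n⇒m≤1+n (m≤n+m m d)))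
    unattacked (refl , r₁<rq) | p , pS | p' , pT | p<m | p'<m | tri> _ _ r₁<r
      with triple (proj₁ t) r₁ r c m p' r₁<r (entry≡ pT) (entry≡ atT) p'<m
    ... | v , ev , p'<v with class-cell t s (at {T} {r₁} {suc c} ev)
    ...   | v' , pv' = <-asym (<-trans p<m (class-order t s pT (at ev) atS pv' p'<v))
                              (row-decreasing (proj₁ s) (n<1+n c) pS pv')

    survives : ∀ j → j < suc d → ∃₂ λ r' c' → S [ r' , c' ]= suc (j + m) × Safe (r₁ , c₁) (r' , c')
    survives j (s≤s l) with m≤n⇒m<n∨m≡n l
    ... | inj₂ refl = rq , suc c , atq , s≤s c₁≤c , unattacked
    ... | inj₁ l' with right j l'
    -- The new cell is at least two columns right of c₁, so it is not attacked.
    ...   | r' , c' , p , l'' = r' , c' , p , <-trans (s≤s c₁≤c) l'' ,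
            λ { (refl , _) → <⇒≱ l'' (s≤s c₁≤c) }

-- Basis lists and matrices

lookup-injective : ∀ {A : Set} {xs : List A} → Unique xs → ∀ i j → lookup xs i ≡ lookup xs j → i ≡ j
lookup-injective {xs = x ∷ xs} u       Fin.zero    Fin.zero    e = refl
lookup-injective {xs = x ∷ xs} u       Fin.zero    (Fin.suc j) refl = ⊥-elim (Unique[x∷xs]⇒x∉xs u (∈-lookup j))
lookup-injective {xs = x ∷ xs} u       (Fin.suc i) Fin.zero    refl = ⊥-elim (Unique[x∷xs]⇒x∉xs u (∈-lookup i))
lookup-injective {xs = x ∷ xs} (_ ∷ u) (Fin.suc i) (Fin.suc j) e = cong Fin.suc (lookup-injective u i j e)

module Matrices {a ℓ : Level} (K : CommutativeRing a ℓ) where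
  open CommutativeRing K
    using (Carrier; _≈_; 0#; 1#; setoid; semiring; reflexive; +-cong; +-congˡ; +-identityˡ; +-identityʳ;
           *-cong; *-congˡ; *-congʳ; *-comm; *-assoc; *-identityˡ; *-identityʳ; zeroˡ; zeroʳ)
    renaming (refl to ≈-refl; sym to ≈-sym; trans to ≈-trans; _+_ to _⊕_; _*_ to _·_)
  open SetoidReasoning setoid
  open SemiringSum semiring using (sum; ∑-comm; *-distribˡ-sum)

  ∑ : ∀ {N} → (Fin N → Carrier) → Carrier
  ∑ = Σ[_] K

  ∑≡sum : ∀ {N} (f : Fin N → Carrier) → ∑ f ≡ sum f
  ∑≡sum {zero}  f = refl
  ∑≡sum {suc N} f = cong (f Fin.zero ⊕_) (∑≡sum (f ∘ Fin.suc))

  ∑-cong : ∀ {N} {f g : Fin N → Carrier} → (∀ l → f l ≈ g l) → ∑ f ≈ ∑ g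
  ∑-cong {zero}  h = ≈-refl
  ∑-cong {suc N} h = +-cong (h Fin.zero) (∑-cong (h ∘ Fin.suc))

  ∑-zero : ∀ {N} {f : Fin N → Carrier} → (∀ l → f l ≈ 0#) → ∑ f ≈ 0#
  ∑-zero {zero}  h = ≈-refl
  ∑-zero {suc N} h = ≈-trans (+-cong (h Fin.zero) (∑-zero (h ∘ Fin.suc))) (+-identityˡ 0#)

  ∑-single : ∀ {N} {f : Fin N → Carrier} j → (∀ l → ¬ l ≡ j → f l ≈ 0#) → ∑ f ≈ f j
  ∑-single Fin.zero    h = ≈-trans (+-congˡ (∑-zero λ l → h (Fin.suc l) λ ())) (+-identityʳ _)
  ∑-single (Fin.suc j) h = ≈-trans
    (+-cong (h Fin.zero λ ()) (∑-single j λ l l≢j → h (Fin.suc l) (l≢j ∘ Fin-suc-injective))) (+-identityˡ _)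

  ∑-swap : ∀ {N N'} (f : Fin N → Fin N' → Carrier) → ∑ (λ i → ∑ (f i)) ≈ ∑ (λ j → ∑ (λ i → f i j))
  ∑-swap f = begin
    ∑ (λ i → ∑ (f i))              ≈⟨ ∑-cong (λ i → reflexive (∑≡sum (f i))) ⟩
    ∑ (λ i → sum (f i))            ≡⟨ ∑≡sum (λ i → sum (f i)) ⟩
    sum (λ i → sum (f i))          ≈⟨ ∑-comm f ⟩
    sum (λ j → sum (λ i → f i j))  ≡⟨ ∑≡sum (λ j → sum (λ i → f i j)) ⟨
    ∑ (λ j → sum (λ i → f i j))    ≈⟨ ∑-cong (λ j → reflexive (∑≡sum (λ i → f i j))) ⟨
    ∑ (λ j → ∑ (λ i → f i j))      ∎

  ·-∑ : ∀ {N} x (f : Fin N → Carrier) → x · ∑ f ≈ ∑ (λ l → x · f l)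
  ·-∑ x f = begin
    x · ∑ f              ≡⟨ cong (x ·_) (∑≡sum f) ⟩
    x · sum f            ≈⟨ *-distribˡ-sum x f ⟩
    sum (λ l → x · f l)  ≡⟨ ∑≡sum (λ l → x · f l) ⟨
    ∑ (λ l → x · f l)    ∎

  ∑-· : ∀ {N} (f : Fin N → Carrier) x → ∑ f · x ≈ ∑ (λ l → f l · x)
  ∑-· f x = ≈-trans (*-comm _ x) (≈-trans (·-∑ x f) (∑-cong λ l → *-comm x (f l)))

  infixl 7 _⊗_
  infix 4 _≋_

  _⊗_ : ∀ {N} → Mat K N → Mat K N → Mat K N
  (A ⊗ B) k j = ∑ λ l → A k l · B l j

  _≋_ : ∀ {N} → Mat K N → Mat K N → Set ℓ
  A ≋ B = ∀ k j → A k j ≈ B k j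

  ≋-sym : ∀ {N} {A B : Mat K N} → A ≋ B → B ≋ A
  ≋-sym e k j = ≈-sym (e k j)

  ≋-trans : ∀ {N} {A B C : Mat K N} → A ≋ B → B ≋ C → A ≋ C
  ≋-trans e e' k j = ≈-trans (e k j) (e' k j)

  ⊗-cong : ∀ {N} {A A' B B' : Mat K N} → A ≋ A' → B ≋ B' → A ⊗ B ≋ A' ⊗ B'
  ⊗-cong e e' k j = ∑-cong λ l → *-cong (e k l) (e' l j)

  ≋-refl : ∀ {N} {A : Mat K N} → A ≋ A
  ≋-refl k j = ≈-refl

  ⊗-assoc : ∀ {N} (A B C : Mat K N) → (A ⊗ B) ⊗ C ≋ A ⊗ (B ⊗ C)
  ⊗-assoc A B C k j = begin
    ∑ (λ l → ∑ (λ p → A k p · B p l) · C l j)    ≈⟨ ∑-cong (λ l → ∑-· (λ p → A k p · B p l) (C l j)) ⟩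
    ∑ (λ l → ∑ (λ p → A k p · B p l · C l j))    ≈⟨ ∑-swap (λ l p → A k p · B p l · C l j) ⟩
    ∑ (λ p → ∑ (λ l → A k p · B p l · C l j))    ≈⟨ ∑-cong (λ p → ∑-cong λ l → *-assoc (A k p) (B p l) (C l j)) ⟩
    ∑ (λ p → ∑ (λ l → A k p · (B p l · C l j)))  ≈⟨ ∑-cong (λ p → ·-∑ (A k p) (λ l → B p l · C l j)) ⟨
    ∑ (λ p → A k p · ∑ (λ l → B p l · C l j))    ∎

  ⊗-commutes : ∀ {N} {M A B : Mat K N} → M ⊗ A ≋ A ⊗ M → M ⊗ B ≋ B ⊗ M → M ⊗ (A ⊗ B) ≋ (A ⊗ B) ⊗ M
  ⊗-commutes {M = M} {A} {B} a b =
    ≋-trans (≋-sym (⊗-assoc M A B)) (≋-trans (⊗-cong a (≋-refl {A = B})) (≋-trans (⊗-assoc A M B)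
      (≋-trans (⊗-cong (≋-refl {A = A}) b) (≋-sym (⊗-assoc A B M)))))

  -- Serves both the converse direction of the theorem and the empty word, whose matrix is the
  -- identity.
  scalar-commutes : ∀ {N} {M : Mat K N} → IsScalar K N M → ∀ A → M ⊗ A ≋ A ⊗ M
  scalar-commutes {N} {M} (z , h) A k j = begin
    ∑ (λ l → M k l · A l j)  ≈⟨ ∑-single k (λ l l≢k → ≈-trans (*-congʳ (off (l≢k ∘ sym))) (zeroˡ _)) ⟩
    M k k · A k j            ≈⟨ *-congʳ (on k) ⟩
    z · A k j                ≈⟨ *-comm z _ ⟩
    A k j · z                ≈⟨ *-congˡ (on j) ⟨
    A k j · M j j            ≈⟨ ∑-single j (λ l l≢j → ≈-trans (*-congˡ (off l≢j)) (zeroʳ _)) ⟨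
    ∑ (λ l → A k l · M l j)  ∎
    where
    on : ∀ k → M k k ≈ z
    on k = ≈-trans (h k k) (reflexive (cong (if_then z else 0#) (dec-true (k Fin.≟ k) refl)))
    off : ∀ {k j} → ¬ k ≡ j → M k j ≈ 0#
    off {k} {j} k≢j = ≈-trans (h k j) (reflexive (cong (if_then z else 0#) (dec-false (k Fin.≟ j) k≢j)))

  coeff : Maybe Tableau → Tableau → Carrier
  coeff (just V) U = ind K (U ==T V)
  coeff nothing  U = 0#

  coeff-hit : ∀ {A U} → A ≡ just U → coeff A U ≈ 1#
  coeff-hit {U = U} refl = reflexive (cong (ind K) (dec-true (List-≡-dec (List-≡-dec _≟_) U U) refl))

  coeff-miss : ∀ A {U} → ¬ A ≡ just U → coeff A U ≈ 0#
  coeff-miss nothing  h = ≈-refl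
  coeff-miss (just V) {U} h =
    reflexive (cong (ind K) (dec-false (List-≡-dec (List-≡-dec _≟_) U V) (h ∘ cong just ∘ sym)))

  πCoeff≡coeff : ∀ i T U → πCoeff K i T U ≡ coeff (act i T) U
  πCoeff≡coeff i T U with inD T i | attacksNext T i
  ... | false | _     = refl
  ... | true  | true  = refl
  ... | true  | false = refl

-- Endomorphisms of the module

module Endomorphism {a ℓ : Level} (K : CommutativeRing a ℓ) {n : ℕ} {α : List ℕ} {T₀ : Tableau} (sct₀ : SCT n α T₀)
  {Es : List Tableau} (unique : Unique Es) (mem : ∀ T → (T ∈ Es) ⇔ (SCT n α T × T ∼ T₀))
  {M : Mat K (length Es)} (endo : IsEndo K n Es M) where

  open CommutativeRing K
    using (_≈_; 0#; 1#; setoid; reflexive; *-congˡ; *-congʳ; *-identityˡ; *-identityʳ; zeroˡ; zeroʳ)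
    renaming (sym to ≈-sym; trans to ≈-trans; _*_ to _·_)
  open SetoidReasoning setoid
  open Matrices K
  open Class sct₀

  N : ℕ
  N = length Es

  tab : Fin N → Tableau
  tab = lookup Es

  tab-class : ∀ j → InClass (tab j)
  tab-class j = Equivalence.to (mem _) (∈-lookup j)

  tab-surjective : ∀ {U} → InClass U → ∃ λ u → tab u ≡ U
  tab-surjective u = let U∈ = Equivalence.from (mem _) u in index U∈ , sym (lookup-index U∈)

  wordMat : List ℕ → Mat K N
  wordMat w k j = coeff (actWord w (tab j)) (tab k)

  wordMat-∷ : ∀ i w → All Letter w → wordMat (i ∷ w) ≋ πMat K Es i ⊗ wordMat w
  wordMat-∷ i w letters k j with actWord w (tab j) in eq
  ... | nothing = ≈-sym (∑-zero {f = λ l → πMat K Es i k l · 0#} λ l → zeroʳ _)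
  -- The class is closed under the letters, so the intermediate tableau is a basis element and is
  -- the only summand of the product that contributes.
  ... | just V with tab-surjective (actWord-class (tab-class j) letters eq)
  ...   | p , refl = begin
    coeff (act i (tab p)) (tab k)                        ≡⟨ πCoeff≡coeff i (tab p) (tab k) ⟨
    πMat K Es i k p                                      ≈⟨ *-identityʳ _ ⟨
    πMat K Es i k p · 1#                                 ≈⟨ *-congˡ (coeff-hit {just (tab p)} refl) ⟨
    πMat K Es i k p · coeff (just (tab p)) (tab p)       ≈⟨ ∑-single p off ⟨
    ∑ (λ l → πMat K Es i k l · coeff (just (tab p)) (tab l)) ∎
    where
    off : ∀ l → ¬ l ≡ p → πMat K Es i k l · coeff (just (tab p)) (tab l) ≈ 0#
    off l l≢p = ≈-trans
      (*-congˡ (coeff-miss (just (tab p)) (l≢p ∘ sym ∘ lookup-injective unique p l ∘ just-injective))) (zeroʳ _)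

  word-commutes : ∀ {w} → All Letter w → M ⊗ wordMat w ≋ wordMat w ⊗ M
  word-commutes [] = ≋-sym (scalar-commutes (1# , unit) M)
    where
    unit : ∀ k j → wordMat [] k j ≈ (if does (k Fin.≟ j) then 1# else 0#)
    unit k j with k Fin.≟ j
    ... | yes refl = coeff-hit {just (tab k)} refl
    ... | no k≢j   = coeff-miss _ (k≢j ∘ sym ∘ lookup-injective unique j k ∘ just-injective)
  word-commutes {i ∷ w} (l ∷ letters) =
    ≋-trans (⊗-cong (≋-refl {A = M}) e) (≋-trans
      (⊗-commutes {A = πMat K Es i} (endo i (proj₁ l) (proj₂ l)) (word-commutes letters))
      (⊗-cong (≋-sym e) (≋-refl {A = M})))
    where
    e : wordMat (i ∷ w) ≋ πMat K Es i ⊗ wordMat w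
    e = wordMat-∷ i w letters

  -- With f the endomorphism of matrix M, this is the coefficient form of f(wT) = w f(T), column j
  -- of M being f at the j-th basis tableau.
  image-just : ∀ {w j j'} → All Letter w → actWord w (tab j) ≡ just (tab j') → ∀ k →
    M k j' ≈ ∑ (λ l → wordMat w k l · M l j)
  image-just {w} {j} {j'} letters e k = ≈-trans (≈-sym (≈-trans
    (∑-single j' λ l l≢j' → ≈-trans (*-congˡ (coeff-miss _ λ e' →
      l≢j' (lookup-injective unique l j' (just-injective (trans (sym e') e))))) (zeroʳ _))
    (≈-trans (*-congˡ (coeff-hit e)) (*-identityʳ _)))) (word-commutes letters k j)

  image-nothing : ∀ {w j} → All Letter w → actWord w (tab j) ≡ nothing → ∀ k →
    0# ≈ ∑ (λ l → wordMat w k l · M l j)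
  image-nothing {w} {j} letters e k = ≈-trans
    (≈-sym (∑-zero {f = λ l → M k l · wordMat w l j} λ l →
      ≈-trans (*-congˡ (reflexive (cong (λ A → coeff A (tab l)) e))) (zeroʳ _)))
    (word-commutes letters k j)

  module FromSource {s : Fin N} (src : IsSource (tab s)) where

    S : Tableau
    S = tab s

    -- π_m fixes S, but no image under π_m involves a tableau with descent m.
    descent-vanish : ∀ {j m r c r' c' r₁ c₁ r₁' c₁'} → S [ r , c ]= m → S [ r' , c' ]= suc m → c' < c →
      tab j [ r₁ , c₁ ]= m → tab j [ r₁' , c₁' ]= suc m → c₁ ≤ c₁' → M j s ≈ 0#
    descent-vanish {j} {m} p p' l q q' l' = ≈-trans (image-just {m ∷ []} (letter ∷ []) fixed j)
      (∑-zero λ k → ≈-trans (*-congʳ (coeff-miss _ (not-image (tab-class k)))) (zeroˡ _))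
      where
      letter : Letter m
      letter = proj₁ (at-bounds (proj₁ (tab-class s)) p) , proj₂ (at-bounds (proj₁ (tab-class s)) p')

      fixed : act m S ≡ just S
      fixed with act m S | actView (class-injective (tab-class s)) p p'
      ... | _ | stay _   = refl
      ... | _ | kill h _ = ⊥-elim (<⇒≱ l h)
      ... | _ | move h   = ⊥-elim (<-asym l (proj₁ h))

      column : ∀ {k r c r' c'} → tab j [ r , c ]= k → tab j [ r' , c' ]= k → c ≡ c'
      column x y = ,-injectiveʳ (class-injective (tab-class j) x y)

      not-image : ∀ {V} → InClass V → ¬ act m V ≡ just (tab j)
      not-image {V} v e
        with locate (proj₁ v) (proj₁ letter) (<⇒≤ (proj₂ letter)) | locate (proj₁ v) (s≤s z≤n) (proj₂ letter)
      ... | r , c , x | r' , c' , x' with act m V | actView (class-injective v) x x'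
      ...   | _ | stay h rewrite just-injective e = <⇒≱ h (subst₂ _≤_ (column q x) (column q' x') l')
      ...   | _ | move h = <⇒≱ (proj₁ h) (subst₂ _≤_
        (column q (subst₂ (λ z → z [ r' , c' ]=_) (just-injective e) (swap-high m) (at-map⁺ x')))
        (column q' (subst₂ (λ z → z [ r , c ]=_) (just-injective e) (swap-low m) (at-map⁺ x))) l')

    nondescent-or-vanish : ∀ {j m} (δ : LargestDiff S (tab j) m) → let open LargestDiff δ in
      (∀ {r' c'} → S [ r' , c' ]= suc m → c' < c → c' < c₁) ⊎ M j s ≈ 0#
    nondescent-or-vanish {j} {m} (diff {c = c} {c₁ = c₁} atS atT apart agree) with suc m ≤? n
    ... | no m≮n = inj₁ λ p _ → ⊥-elim (m≮n (proj₂ (at-bounds (proj₁ (tab-class s)) p)))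
    ... | yes m<n with locate (proj₁ (tab-class s)) (s≤s z≤n) m<n
    ...   | r' , c' , p with c' <? c | c' <? c₁
    ...     | no c'≮c  | _ = inj₁ λ p' l →
        ⊥-elim (c'≮c (subst (_< c) (,-injectiveʳ (class-injective (tab-class s) p' p)) l))
    ...     | yes _    | yes c'<c₁ = inj₁ λ p' _ →
        subst (_< c₁) (,-injectiveʳ (class-injective (tab-class s) p p')) c'<c₁
    ...     | yes c'<c | no c'≮c₁ = inj₂ (descent-vanish atS p c'<c atT (agree (n<1+n m) p) (≮⇒≥ c'≮c₁))

    -- `f` is the fuel of the descending induction: once it is used up, the bound would force m > n,
    -- beyond all entries.
    vanish : ∀ f {j m} → n < f + m → LargestDiff S (tab j) m → M j s ≈ 0#
    vanish zero l δ = ⊥-elim (<⇒≱ l (proj₂ (at-bounds (proj₁ (tab-class s)) (LargestDiff.atS δ))))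
    vanish (suc f) {j} {m} n<f+m δ with nondescent-or-vanish δ
    ... | inj₂ z = z
    ... | inj₁ nondescent with separate src (tab-class s) (tab-class j) δ nondescent
    -- The coefficients of `tab u`, the image of `tab j` under w, are compared in f(wS) = w f(S),
    -- whose left side is zero.
    ...   | separator {d} atq right survives = ≈-sym (begin
      0#                           ≈⟨ image-nothing letters killed u ⟩
      ∑ (λ l → wordMat w u l · M l s)  ≈⟨ ∑-single j others ⟩
      wordMat w u j · M j s        ≈⟨ *-congʳ (coeff-hit (trans survived (cong just (sym u≡)))) ⟩
      1# · M j s                   ≈⟨ *-identityˡ _ ⟩
      M j s                        ∎)
      where
      open LargestDiff δ

      w : List ℕ
      w = pushWord m (suc d)

      letters : All Letter w
      letters = pushWord-letters (suc d)
        (proj₁ (at-bounds (proj₁ (tab-class s)) atS)) (proj₂ (at-bounds (proj₁ (tab-class s)) atq))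

      above : ∀ {i} → m < suc (i + m)
      above {i} = s≤s (m≤n+m m i)

      killed : actWord w S ≡ nothing
      killed = push-killed d (class-injective (tab-class s)) atS
        (λ i l → let r' , c' , p , h = right i l in r' , c' , p , <⇒≤ h) atq

      survived : actWord w (tab j) ≡ just (push m (suc d) (tab j))
      survived = push-survives (suc d) (class-injective (tab-class j)) atT
        λ i l → let r' , c' , p , h = survives i l in r' , c' , agree above p , h

      U : ∃ λ u → tab u ≡ push m (suc d) (tab j)
      U = tab-surjective (actWord-class (tab-class j) letters survived)

      u : Fin N
      u = proj₁ U

      u≡ : tab u ≡ push m (suc d) (tab j)
      u≡ = proj₂ U

      missed : ∀ l → ¬ actWord w (tab l) ≡ just (tab u) → wordMat w u l · M l s ≈ 0#
      missed l h = ≈-trans (*-congʳ (coeff-miss _ h)) (zeroˡ _)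

      dead : ∀ {A : Maybe Tableau} {V} → A ≡ nothing → ¬ A ≡ just V
      dead refl ()

      weakly-right : ∀ i → i < suc d → ∃₂ λ r' c' → S [ r' , c' ]= suc (i + m) × c ≤ c'
      weakly-right i (s≤s l) with m≤n⇒m<n∨m≡n l
      ... | inj₁ l'   = let r' , c' , p , h = right i l' in r' , c' , p , <⇒≤ h
      ... | inj₂ refl = _ , _ , atq , ≤-refl

      others : ∀ l → ¬ l ≡ j → wordMat w u l · M l s ≈ 0#
      others l l≢j with equal-or-diff (tab-class s) (tab-class l)
      ... | inj₁ e = missed l (dead (subst (λ T → actWord w T ≡ nothing) e killed))
      ... | inj₂ (m' , δ') with <-cmp m' m
      ...   | tri> _ _ m<m' = ≈-trans (*-congˡ (vanish f (<-≤-trans n<f+m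
                (≤-trans (≤-reflexive (sym (+-suc f m))) (+-monoʳ-≤ f m<m'))) δ')) (zeroʳ _)
      ...   | tri< m'<m _ _ = missed l (dead (push-killed d (class-injective (tab-class l)) (LargestDiff.agree δ' m'<m atS)
                (λ i l → let r' , c' , p , h = right i l in r' , c' , LargestDiff.agree δ' (<-trans m'<m above) p , <⇒≤ h)
                (LargestDiff.agree δ' (<-trans m'<m above) atq)))
      ...   | tri≈ _ refl _ = missed l not-hit
        where
        -- As m + 1, ..., q lie weakly right of column c, this bound puts them weakly right of m in
        -- `tab l`. So w acts there as zero or as `push`, and `push` is injective.
        c₁'≤c : LargestDiff.c₁ δ' ≤ c
        c₁'≤c = <⇒≤ (subst (LargestDiff.c₁ δ' <_) (,-injectiveʳ (class-injective (tab-class s) (LargestDiff.atS δ') atS))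
          (diff-moves-left src (tab-class s) (tab-class l) δ'))
        not-hit : ¬ actWord w (tab l) ≡ just (tab u)
        not-hit e with push-run (suc d) (class-injective (tab-class l)) (LargestDiff.atT δ')
          (λ i l → let r' , c' , p , h = weakly-right i l in r' , c' , LargestDiff.agree δ' above p , ≤-trans c₁'≤c h)
        ... | inj₁ e' = dead e' e
        ... | inj₂ e' = l≢j (lookup-injective unique l j (push-cancel m (suc d)
                (trans (just-injective (trans (sym e') e)) u≡)))

    offdiagonal : ∀ l → ¬ l ≡ s → M l s ≈ 0#
    offdiagonal l l≢s with equal-or-diff (tab-class s) (tab-class l)
    ... | inj₁ e       = ⊥-elim (l≢s (sym (lookup-injective unique s l e)))
    ... | inj₂ (m , δ) = vanish (suc n) (m≤m+n (suc n) m) δ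

    -- By uniqueness the source reached from `tab j` is S, so `tab j` = wS and its image is w f(S),
    -- where f(S) is `M s s` times S.
    scalar : ∀ k j → M k j ≈ (if does (k Fin.≟ j) then M s s else 0#)
    scalar k j with toSource (tab-class j)
    ... | S' , w , s' , src' , letters , e = begin
      M k j                            ≈⟨ image-just letters e' k ⟩
      ∑ (λ l → wordMat w k l · M l s)  ≈⟨ ∑-single s (λ l l≢s → ≈-trans (*-congˡ (offdiagonal l l≢s)) (zeroʳ _)) ⟩
      wordMat w k s · M s s            ≈⟨ entry-of (k Fin.≟ j) ⟩
      (if does (k Fin.≟ j) then M s s else 0#) ∎
      where
      e' : actWord w (tab s) ≡ just (tab j)
      e' = subst (λ T → actWord w T ≡ just (tab j)) (source-unique src' src s' (tab-class s)) e
      entry-of : (k≟j : Dec (k ≡ j)) → wordMat w k s · M s s ≈ (if does k≟j then M s s else 0#)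
      entry-of (yes refl) = ≈-trans (*-congʳ (coeff-hit e')) (*-identityˡ _)
      entry-of (no k≢j)   = ≈-trans (*-congʳ (coeff-miss _ λ e'' →
        k≢j (sym (lookup-injective unique j k (just-injective (trans (sym e') e'')))))) (zeroˡ _)

  isScalar : IsScalar K N M
  isScalar with toSource (sct₀ , ∼-refl)
    where
    ∼-refl : T₀ ∼ T₀
    ∼-refl r r' k a b a' b' p q p' q' with trans (sym p) p' | trans (sym q) q'
    ... | refl | refl = mk⇔ id id
  ... | S , _ , cls , src , _ with tab-surjective cls
  ...   | s , refl = M s s , FromSource.scalar src

theorem4p11 : {c ℓ : Level} (K : CommutativeRing c ℓ) → IsChar0Field K →
    (n : ℕ) → 1 ≤ n → (α : List ℕ) → IsComposition n α →
    (T₀ : Tableau) → SCT n α T₀ →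
    (Es : List Tableau) → Unique Es → (∀ T → (T ∈ Es) ⇔ (SCT n α T × T ∼ T₀)) →
    (M : Mat K (length Es)) →
    IsEndo K n Es M ⇔ IsScalar K (length Es) M
theorem4p11 K _ n _ α _ T₀ sct₀ Es unique mem M = mk⇔
  (λ endo → Endomorphism.isScalar K sct₀ unique mem endo)
  (λ scalar i _ _ → Matrices.scalar-commutes K scalar (πMat K Es i))
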